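{- For every integer $n\ge1$, the $3$-adic valuation of the denominator $\alpha_{n,2}$ of $A_{n,2}(x)$ is $$\nu_3(\alpha_{n,2})=\begin{cases}\nu_3(n!\,\operatorname{lcm}(1,2,\dots,n))-1 & \text{if } n=2\cdot 3^m\text{ for some integer } m\ge1,\\ \nu_3(n!\,\operatorname{lcm}(1,2,\dots,n)) & \text{otherwise.}\end{cases}$$
   Context: Let $f_0(x)=\ln(1+x^2)$ and $f_n(x)=\int_0^x f_{n-1}(t)\,dt$ for $n\ge1$ ($x$ real). For each $n\ge 0$, $A_{n,2},B_{n,2},C_{n,2}$ denote the (uniquely determined) polynomials with $$f_n(x)=A_{n,2}(x)+B_{n,2}(x)\arctan x+C_{n,2}(x)\ln(1+x^2).$$ Explicitly, $A_{n,2}(x)=\frac{i}{n!}\left[x\varphi_n(x)-\sum_{k=2}^n\frac{x^k\varphi_{n-k+1}(x)}{k(k-1)}\right]$ with $\varphi_m(x)=(x+i)^m-(x-i)^m$, $i=\sqrt{ -1}$; it has rational coefficients. The denominator $\alpha_{n,2}$ of $A_{n,2}(x)$ is the least positive integer $d$ such that $d\,A_{n,2}(x)\in\mathbb{Z}[x]$. $\nu_3(m)$ is the exponent of the highest power of $3$ dividing $m$. -}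

module Defs where

open import Data.Integer.Base using (+_)
open import Data.List.Base using (List; []; _∷_; map; foldr; upTo; applyUpTo)
open import Data.List.Relation.Unary.All using (All)
open import Data.Nat.Base using (ℕ; zero; suc; _+_; _*_; _^_; _∸_; _≤_; _<_; NonZero; _!)
open import Data.Nat.Divisibility using (_∣?_)
open import Data.Nat.LCM using (lcm)
open import Data.Nat.Properties using (_!≢0)
open import Data.Product.Base using (∃-syntax)
open import Data.Rational.Base as ℚ using (ℚ; 0ℚ; 1ℚ)
open import Relation.Binary.PropositionalEquality.Core using (_≡_)
open import Relation.Nullary.Decidable.Core using (yes; no)

------------------------------------------------------------------------
-- The field ℚ(i)

infix  5 _+i_
infixl 6 _⊞_
infixl 7 _⊠_

-- a +i b is a + b·i
record ℚ[i] : Set where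
  constructor _+i_
  field
    re : ℚ
    im : ℚ

open ℚ[i] public

fromℚ : ℚ → ℚ[i]
fromℚ q = q +i 0ℚ

0# 1# 𝕚 : ℚ[i]
0# = fromℚ 0ℚ
1# = fromℚ 1ℚ
𝕚  = 0ℚ +i 1ℚ

_⊞_ _⊠_ : ℚ[i] → ℚ[i] → ℚ[i]
(a +i b) ⊞ (c +i d) = (a ℚ.+ c) +i (b ℚ.+ d)
(a +i b) ⊠ (c +i d) = (a ℚ.* c ℚ.- b ℚ.* d) +i (a ℚ.* d ℚ.+ b ℚ.* c)

⊟_ : ℚ[i] → ℚ[i]
⊟ (a +i b) = (ℚ.- a) +i (ℚ.- b)

------------------------------------------------------------------------
-- Polynomials over ℚ(i)

-- Coefficient lists, constant term first.  Trailing zeros are allowed, so a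
-- polynomial has several representations; nothing below depends on which one
-- is used.
Poly : Set
Poly = List ℚ[i]

infixl 6 _+ₚ_ _-ₚ_
infixl 7 _*ₚ_ _·ₚ_
infixr 8 _^ₚ_

_+ₚ_ : Poly → Poly → Poly
[]      +ₚ q       = q
(a ∷ p) +ₚ []      = a ∷ p
(a ∷ p) +ₚ (b ∷ q) = (a ⊞ b) ∷ (p +ₚ q)

_·ₚ_ : ℚ[i] → Poly → Poly
c ·ₚ p = map (c ⊠_) p

_-ₚ_ : Poly → Poly → Poly
p -ₚ q = p +ₚ map ⊟_ q

_*ₚ_ : Poly → Poly → Poly
[]      *ₚ q = []
(a ∷ p) *ₚ q = (a ·ₚ q) +ₚ (0# ∷ (p *ₚ q))

_^ₚ_ : Poly → ℕ → Poly
p ^ₚ zero  = 1# ∷ []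
p ^ₚ suc n = p *ₚ (p ^ₚ n)

X : Poly
X = 0# ∷ 1# ∷ []

const : ℚ[i] → Poly
const c = c ∷ []

sumₚ : List Poly → Poly
sumₚ = foldr _+ₚ_ []

------------------------------------------------------------------------
-- The polynomials A_{n,2}

-- With f₀(x) = ln(1+x²) and fₙ(x) = ∫₀ˣ fₙ₋₁, the function fₙ is uniquely
--   A_{n,2}(x) + B_{n,2}(x) arctan x + C_{n,2}(x) ln(1+x²)
-- with polynomial A, B, C.  A₂ n is A_{n,2}, by its closed formula
--   A_{n,2} = (i/n!) [ x φₙ − Σ_{k=2}^{n} x^k φ_{n−k+1} / (k(k−1)) ],
--   φₘ = (x+i)^m − (x−i)^m.

φ : ℕ → Poly
φ m = (X +ₚ const 𝕚) ^ₚ m -ₚ (X -ₚ const 𝕚) ^ₚ m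

1/_ : (d : ℕ) .{{_ : NonZero d}} → ℚ[i]
1/ d = fromℚ (+ 1 ℚ./ d)

-- The index k = 2, …, n of the sum is written k = 2 + j with j < n − 1.
A₂ : ℕ → Poly
A₂ n = (𝕚 ⊠ (1/ (n !)) {{n !≢0}}) ·ₚ (X *ₚ φ n -ₚ sumₚ (map term (upTo (n ∸ 1))))
  where
  term : ℕ → Poly
  term j = let k = suc (suc j) in
    (1/ (k * suc j)) ·ₚ (X ^ₚ k *ₚ φ (n ∸ k + 1))

------------------------------------------------------------------------
-- Denominators

IsInteger : ℚ[i] → Set
IsInteger z = ∃[ k ] z ≡ fromℚ (k ℚ./ 1)

-- Membership in ℤ[x] ⊂ ℚ(i)[x]; in particular all coefficients are real.
Integral : Poly → Set
Integral = All IsInteger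

fromℕ : ℕ → ℚ[i]
fromℕ d = fromℚ (+ d ℚ./ 1)

record IsDenominator (p : Poly) (d : ℕ) : Set where
  field
    positive : 0 < d
    integral : Integral (fromℕ d ·ₚ p)
    least    : ∀ e → 0 < e → Integral (fromℕ e ·ₚ p) → d ≤ e

------------------------------------------------------------------------
-- Arithmetic functions

-- The largest e ≤ b with p ^ e ∣ m.
greatestExponent : (p m b : ℕ) → ℕ
greatestExponent p m zero    = 0
greatestExponent p m (suc b) with p ^ suc b ∣? m
... | yes _ = suc b
... | no  _ = greatestExponent p m b

-- The p-adic valuation, for p ≥ 2 and m ≥ 1: bounding the search by m loses
-- nothing, since p ^ e ∣ m gives e < p ^ e ≤ m.
ν : (p m : ℕ) → ℕ
ν p m = greatestExponent p m m

-- lcm(1, 2, …, n)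
lcmUpTo : ℕ → ℕ
lcmUpTo n = foldr lcm 1 (applyUpTo suc n)

{-# OPTIONS --safe #-}
module Submission where

-- Write s for n − j and L for lcm(1, …, n).  Summation by parts, using
-- 1/(k(k−1)) = 1/(k−1) − 1/k, turns the coefficient of x^j in n!·L·A_{n,2} into
-- w s · Σ_{k=1}^{n} C(n−k, s)·(L/k), where w = −2, 0, 2, 0, −2, ….
-- Let 3^e be the largest power of 3 up to n.  Modulo 3 only k = 3^e and, if it
-- is at most n, k = 2·3^e contribute, since L/k is otherwise divisible by 3.
-- Summing the sums over all even s replaces C(m, s) by 2^(m−1) (by 1 if m = 0);
-- the result is a unit modulo 3 unless n = 2·3^e, so some coefficient is a unit.  If
-- n = 2·3^e with e ≥ 1, all coefficients are divisible by 3; the one with s = 0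
-- is 2·L·(1 + 1/2 + ⋯ + 1/n), which is nonzero modulo 9 because modulo 9 only the
-- multiples of 3^(e−1) contribute and 1 + 1/2 + ⋯ + 1/6 = 49/20.

open import Defs
open import Algebra.Bundles using (CommutativeRing)
open import Algebra.Solver.Ring.AlmostCommutativeRing using (fromCommutativeRing)
import Algebra.Solver.Ring.Simple
open import Algebra.Structures using (IsCommutativeRing)
open import Data.Integer.Base as ℤ using (ℤ; +_; -[1+_]; +[1+_]; -1ℤ)
import Data.Integer.Divisibility.Signed as ℤ
import Data.Integer.Properties as ℤ
open import Data.List.Base using ([]; _∷_; _∷ʳ_; foldr; map; upTo)
open import Data.List.Membership.Propositional using (_∈_)
open import Data.List.Membership.Propositional.Properties using (∈-applyUpTo⁺)
open import Data.List.Properties using (map-++; upTo-∷ʳ)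
open import Data.List.Relation.Unary.All using (All; []; _∷_)
open import Data.List.Relation.Unary.All.Properties using (applyUpTo⁺₁)
open import Data.List.Relation.Unary.Any using (here; there)
open import Data.Nat.Base as ℕ hiding (∣_-_∣)
open import Data.Nat.Combinatorics using (_C_; k>n⇒nCk≡0; nC1≡n; nCk≡nC[n∸k]; nCk+nC[k+1]≡[n+1]C[k+1])
import Data.Nat.Coprimality as Coprime
open import Data.Nat.Divisibility
open import Data.Nat.DivMod using (m*[n/m]≡n)
open import Data.Nat.GCD using (gcd; gcd[m,n]∣m; gcd[m,n]∣n; c*gcd[m,n]≡gcd[cm,cn]; gcd-greatest; gcd[m,n]≡0⇒m≡0)
open import Data.Nat.LCM using (lcm; m∣lcm[m,n]; n∣lcm[m,n]; lcm-least)
open import Data.Nat.Primality using (Prime; prime?; euclidsLemma)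
open import Data.Nat.Properties
open import Data.Nat.Tactic.RingSolver using (solve-∀)
open import Data.Product.Base using (_×_; _,_; proj₁; proj₂; ∃-syntax; ∃₂)
open import Data.Rational.Base as ℚ using (ℚ; 0ℚ; 1ℚ; mkℚ; ↥_)
import Data.Rational.Properties as ℚ
import Data.Rational.Solver as ℚ
open import Data.Sum.Base using (_⊎_; inj₁; inj₂; [_,_]′)
open import Function.Base using (_∘_; _$_)
open import Function.Bundles using (_⇔_; mk⇔; Equivalence)
open import Function.Properties.Equivalence using () renaming (trans to ⇔-trans)
open import Relation.Binary.Definitions using (DecidableEquality; tri<; tri≈; tri>)
open import Relation.Binary.PropositionalEquality
open import Relation.Nullary using (¬_; yes; no; contradiction)
open import Relation.Nullary.Decidable using (map′; _×-dec_; from-yes; from-no)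

-- Put N = n!·L and let g_s be the absolute value of the s-th numerator. Then d·A_{n,2} is integral
-- exactly when N divides d·g_s for every s, so the denominator is N / gcd(N, g_0, g_1, ...), and
-- only the smallest power of 3 among the g_s matters. Adding the g_s spares the search for a
-- coefficient prime to 3: a sum prime to 3 has a summand prime to 3. The exceptional n come from
-- the binomial sum at m = 0. For n = 2·3^e + t with t > 0 the sum is, modulo 3 and up to a unit,
-- 2^(3^e + 1) + 1, which is 2 since 3^e is odd. For t = 0 the term k = 2·3^e falls on m = 0, where
-- the sum is not half of 2^m, and the result becomes a multiple of 2^(3^e) + 1, hence of 3. The
-- value n = 2 follows the same pattern, but there N = 4 has no factor 3 to lose. The index n ≥ 1 of
-- the theorem appears as `suc n` in most of what follows.

-- The commutative ring ℚ(i)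

⊞-⊠-isCommutativeRing : IsCommutativeRing _≡_ _⊞_ _⊠_ ⊟_ 0# 1#
⊞-⊠-isCommutativeRing = record
  { isRing = record
    { +-isAbelianGroup = record
      { isGroup = record
        { isMonoid = record
          { isSemigroup = record
            { isMagma = record { isEquivalence = isEquivalence ; ∙-cong = cong₂ _⊞_ }
            ; assoc = λ { (a +i b) (c +i d) (e +i f) → cong₂ _+i_ (ℚ.+-assoc a c e) (ℚ.+-assoc b d f) } }
          ; identity = (λ { (a +i b) → cong₂ _+i_ (ℚ.+-identityˡ a) (ℚ.+-identityˡ b) })
                     , (λ { (a +i b) → cong₂ _+i_ (ℚ.+-identityʳ a) (ℚ.+-identityʳ b) }) }
        ; inverse = (λ { (a +i b) → cong₂ _+i_ (ℚ.+-inverseˡ a) (ℚ.+-inverseˡ b) })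
                  , (λ { (a +i b) → cong₂ _+i_ (ℚ.+-inverseʳ a) (ℚ.+-inverseʳ b) })
        ; ⁻¹-cong = cong ⊟_ }
      ; comm = λ { (a +i b) (c +i d) → cong₂ _+i_ (ℚ.+-comm a c) (ℚ.+-comm b d) } }
    ; *-cong = cong₂ _⊠_
    ; *-assoc = λ { (a +i b) (c +i d) (e +i f) → cong₂ _+i_
        (solve 6 (λ a b c d e f → (a :* c :+ :- (b :* d)) :* e :+ :- ((a :* d :+ b :* c) :* f)
           := a :* (c :* e :+ :- (d :* f)) :+ :- (b :* (c :* f :+ d :* e))) refl a b c d e f)
        (solve 6 (λ a b c d e f → (a :* c :+ :- (b :* d)) :* f :+ (a :* d :+ b :* c) :* e
           := a :* (c :* f :+ d :* e) :+ b :* (c :* e :+ :- (d :* f))) refl a b c d e f) }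
    ; *-identity = (λ { (a +i b) → cong₂ _+i_
          (solve 2 (λ a b → con 1ℚ :* a :+ :- (con 0ℚ :* b) := a) refl a b)
          (solve 2 (λ a b → con 1ℚ :* b :+ con 0ℚ :* a := b) refl a b) })
      , (λ { (a +i b) → cong₂ _+i_
          (solve 2 (λ a b → a :* con 1ℚ :+ :- (b :* con 0ℚ) := a) refl a b)
          (solve 2 (λ a b → a :* con 0ℚ :+ b :* con 1ℚ := b) refl a b) })
    ; distrib = (λ { (a +i b) (c +i d) (e +i f) → cong₂ _+i_
          (solve 6 (λ a b c d e f → a :* (c :+ e) :+ :- (b :* (d :+ f))
             := (a :* c :+ :- (b :* d)) :+ (a :* e :+ :- (b :* f))) refl a b c d e f)
          (solve 6 (λ a b c d e f → a :* (d :+ f) :+ b :* (c :+ e)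
             := (a :* d :+ b :* c) :+ (a :* f :+ b :* e)) refl a b c d e f) })
      , (λ { (a +i b) (c +i d) (e +i f) → cong₂ _+i_
          (solve 6 (λ a b c d e f → (c :+ e) :* a :+ :- ((d :+ f) :* b)
             := (c :* a :+ :- (d :* b)) :+ (e :* a :+ :- (f :* b))) refl a b c d e f)
          (solve 6 (λ a b c d e f → (c :+ e) :* b :+ (d :+ f) :* a
             := (c :* b :+ d :* a) :+ (e :* b :+ f :* a)) refl a b c d e f) })
    }
  ; *-comm = λ { (a +i b) (c +i d) → cong₂ _+i_
      (solve 4 (λ a b c d → a :* c :+ :- (b :* d) := c :* a :+ :- (d :* b)) refl a b c d)
      (solve 4 (λ a b c d → a :* d :+ b :* c := c :* b :+ d :* a) refl a b c d) }
  }
  where open ℚ.+-*-Solver using (solve; _:+_; _:*_; :-_; _:=_; con)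

⊞-⊠-commutativeRing : CommutativeRing _ _
⊞-⊠-commutativeRing = record { isCommutativeRing = ⊞-⊠-isCommutativeRing }

_≟ℚ[i]_ : DecidableEquality ℚ[i]
(a +i b) ≟ℚ[i] (c +i d) = map′ (λ (p , q) → cong₂ _+i_ p q) (λ e → cong re e , cong im e) (a ℚ.≟ c ×-dec b ℚ.≟ d)

module ⊞-⊠-Solver = Algebra.Solver.Ring.Simple (fromCommutativeRing ⊞-⊠-commutativeRing) _≟ℚ[i]_

module ℂ = CommutativeRing ⊞-⊠-commutativeRing
open import Algebra.Properties.Semiring.Exp ℂ.semiring using () renaming (_^_ to _^ᶜ_)
open ⊞-⊠-Solver
open ≡-Reasoning

-- Integers inside ℚ(i)

/1≡mkℚ : ∀ z → z ℚ./ 1 ≡ mkℚ z 0 (Coprime.sym (Coprime.1-coprimeTo _))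
/1≡mkℚ z = ℚ.↥p/↧p≡p (mkℚ z 0 (Coprime.sym (Coprime.1-coprimeTo _)))

ι : ℤ → ℚ[i]
ι z = fromℚ (z ℚ./ 1)

ι-+ : ∀ a b → ι (a ℤ.+ b) ≡ ι a ⊞ ι b
ι-+ a b rewrite /1≡mkℚ a | /1≡mkℚ b =
  cong fromℚ (cong (ℚ._/ 1) (sym (cong₂ ℤ._+_ (ℤ.*-identityʳ a) (ℤ.*-identityʳ b))))

/1-* : ∀ a b → (a ℤ.* b) ℚ./ 1 ≡ a ℚ./ 1 ℚ.* (b ℚ./ 1)
/1-* a b rewrite /1≡mkℚ a | /1≡mkℚ b = refl

fromℚ-* : ∀ a b → fromℚ (a ℚ.* b) ≡ fromℚ a ⊠ fromℚ b
fromℚ-* a b = sym (cong₂ _+i_ (ℚ.+-identityʳ (a ℚ.* b))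
  (trans (cong₂ ℚ._+_ (ℚ.*-zeroʳ a) (ℚ.*-zeroˡ b)) refl))

ι-* : ∀ a b → ι (a ℤ.* b) ≡ ι a ⊠ ι b
ι-* a b = trans (cong fromℚ (/1-* a b)) (fromℚ-* (a ℚ./ 1) (b ℚ./ 1))

ι-injective : ∀ {a b} → ι a ≡ ι b → a ≡ b
ι-injective {a} {b} eq = cong ↥_ (trans (sym (/1≡mkℚ a)) (trans (cong re eq) (/1≡mkℚ b)))

ι⁺-+ : ∀ a b → fromℕ (a + b) ≡ fromℕ a ⊞ fromℕ b
ι⁺-+ a b = ι-+ (+ a) (+ b)

ι⁺-* : ∀ a b → fromℕ (a * b) ≡ fromℕ a ⊠ fromℕ b
ι⁺-* a b = trans (cong ι (ℤ.pos-* a b)) (ι-* (+ a) (+ b))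

d⊠1/d≡1 : ∀ d .{{_ : NonZero d}} → fromℕ d ⊠ 1/ d ≡ 1#
d⊠1/d≡1 (suc d) = trans (sym (fromℚ-* (+ suc d ℚ./ 1) (+ 1 ℚ./ suc d))) (cong fromℚ lem)
  where
  d/1 : ℚ
  d/1 = mkℚ +[1+ d ] 0 (Coprime.sym (Coprime.1-coprimeTo _))
  lem : (+ suc d ℚ./ 1) ℚ.* (+ 1 ℚ./ suc d) ≡ 1ℚ
  lem rewrite /1≡mkℚ (+ suc d) | ℚ.↥p/↧p≡p (mkℚ (+ 1) d (Coprime.1-coprimeTo _)) = ℚ.*-inverseʳ d/1

-- Coefficients of polynomials

coeff : Poly → ℕ → ℚ[i]
coeff []      _       = 0#
coeff (a ∷ p) zero    = a
coeff (a ∷ p) (suc j) = coeff p j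

coeff-+ₚ : ∀ p q j → coeff (p +ₚ q) j ≡ coeff p j ⊞ coeff q j
coeff-+ₚ []      q       j       = sym (ℂ.+-identityˡ _)
coeff-+ₚ (a ∷ p) []      j       = sym (ℂ.+-identityʳ _)
coeff-+ₚ (a ∷ p) (b ∷ q) zero    = refl
coeff-+ₚ (a ∷ p) (b ∷ q) (suc j) = coeff-+ₚ p q j

coeff-·ₚ : ∀ c p j → coeff (c ·ₚ p) j ≡ c ⊠ coeff p j
coeff-·ₚ c []      j       = sym (ℂ.zeroʳ c)
coeff-·ₚ c (a ∷ p) zero    = refl
coeff-·ₚ c (a ∷ p) (suc j) = coeff-·ₚ c p j

coeff-⊟ : ∀ p j → coeff (map ⊟_ p) j ≡ ⊟ coeff p j
coeff-⊟ []      j       = refl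
coeff-⊟ (a ∷ p) zero    = refl
coeff-⊟ (a ∷ p) (suc j) = coeff-⊟ p j

coeff--ₚ : ∀ p q j → coeff (p -ₚ q) j ≡ coeff p j ⊞ ⊟ coeff q j
coeff--ₚ p q j = trans (coeff-+ₚ p (map ⊟_ q) j) (cong (coeff p j ⊞_) (coeff-⊟ q j))

-- Cauchy product of coefficient sequences, unfolded at the constant term of f to match the
-- recursion of `_*ₚ_`.
conv : (f g : ℕ → ℚ[i]) → ℕ → ℚ[i]
conv f g zero    = f 0 ⊠ g 0
conv f g (suc j) = f 0 ⊠ g (suc j) ⊞ conv (f ∘ suc) g j

conv-congˡ : ∀ {f f′} g → f ≗ f′ → conv f g ≗ conv f′ g
conv-congˡ g f≗f′ zero    = cong (_⊠ g 0) (f≗f′ 0)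
conv-congˡ g f≗f′ (suc j) = cong₂ _⊞_ (cong (_⊠ g (suc j)) (f≗f′ 0)) (conv-congˡ g (f≗f′ ∘ suc) j)

conv-0 : ∀ g j → conv (coeff []) g j ≡ 0#
conv-0 g zero    = ℂ.zeroˡ (g 0)
conv-0 g (suc j) = trans (cong₂ _⊞_ (ℂ.zeroˡ (g (suc j))) (conv-0 g j)) (ℂ.+-identityˡ _)

conv-1 : ∀ g → conv (coeff (const 1#)) g ≗ g
conv-1 g zero    = ℂ.*-identityˡ (g 0)
conv-1 g (suc j) = trans (cong₂ _⊞_ (ℂ.*-identityˡ (g (suc j))) (conv-0 g j)) (ℂ.+-identityʳ (g (suc j)))

coeff-*ₚ : ∀ p q → coeff (p *ₚ q) ≗ conv (coeff p) (coeff q)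
coeff-*ₚ []      q j       = sym (conv-0 (coeff q) j)
coeff-*ₚ (a ∷ p) q zero    = trans (coeff-+ₚ (a ·ₚ q) _ 0)
  (trans (ℂ.+-identityʳ _) (coeff-·ₚ a q 0))
coeff-*ₚ (a ∷ p) q (suc j) = trans (coeff-+ₚ (a ·ₚ q) _ (suc j))
  (cong₂ _⊞_ (coeff-·ₚ a q (suc j)) (coeff-*ₚ p q j))

coeff-[X+c]*ₚ : ∀ c q j → coeff ((X +ₚ const c) *ₚ q) (suc j) ≡ c ⊠ coeff q (suc j) ⊞ coeff q j
coeff-[X+c]*ₚ c q j = trans (coeff-*ₚ (X +ₚ const c) q (suc j))
  (cong₂ _⊞_ (cong (_⊠ coeff q (suc j)) (ℂ.+-identityˡ c)) (conv-1 (coeff q) j))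

suc[m∸1+j]≡m∸j : ∀ {m j} → j < m → suc (m ∸ suc j) ≡ m ∸ j
suc[m∸1+j]≡m∸j j<m = sym (+-∸-assoc 1 j<m)

coeff-[X+c]^ₚ : ∀ c m j → coeff ((X +ₚ const c) ^ₚ m) j ≡ fromℕ (m C j) ⊠ c ^ᶜ (m ∸ j)
coeff-[X+c]^ₚ c zero    zero    = refl
coeff-[X+c]^ₚ c zero    (suc j) = refl
coeff-[X+c]^ₚ c (suc m) zero    = begin
  coeff ((X +ₚ const c) *ₚ P) 0     ≡⟨ coeff-*ₚ (X +ₚ const c) P 0 ⟩
  (0# ⊞ c) ⊠ coeff P 0              ≡⟨ cong₂ _⊠_ (ℂ.+-identityˡ c) (coeff-[X+c]^ₚ c m 0) ⟩
  c ⊠ (1# ⊠ c ^ᶜ m)                 ≡⟨ solve 2 (λ c x → c :* (con 1# :* x) := con 1# :* (c :* x)) refl c (c ^ᶜ m) ⟩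
  1# ⊠ (c ⊠ c ^ᶜ m)                 ∎
  where P = (X +ₚ const c) ^ₚ m
coeff-[X+c]^ₚ c (suc m) (suc j) = begin
  coeff ((X +ₚ const c) *ₚ P) (suc j)
    ≡⟨ coeff-[X+c]*ₚ c P j ⟩
  c ⊠ coeff P (suc j) ⊞ coeff P j
    ≡⟨ cong₂ (λ x y → c ⊠ x ⊞ y) (coeff-[X+c]^ₚ c m (suc j)) (coeff-[X+c]^ₚ c m j) ⟩
  c ⊠ (fromℕ (m C suc j) ⊠ c ^ᶜ (m ∸ suc j)) ⊞ fromℕ (m C j) ⊠ c ^ᶜ (m ∸ j)
    ≡⟨ cong (_⊞ fromℕ (m C j) ⊠ c ^ᶜ (m ∸ j)) absorb ⟩
  fromℕ (m C suc j) ⊠ c ^ᶜ (m ∸ j) ⊞ fromℕ (m C j) ⊠ c ^ᶜ (m ∸ j)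
    ≡⟨ solve 3 (λ a b x → a :* x :+ b :* x := (b :+ a) :* x) refl (fromℕ (m C suc j)) (fromℕ (m C j)) (c ^ᶜ (m ∸ j)) ⟩
  (fromℕ (m C j) ⊞ fromℕ (m C suc j)) ⊠ c ^ᶜ (m ∸ j)
    ≡⟨ cong (_⊠ c ^ᶜ (m ∸ j)) (ι⁺-+ (m C j) (m C suc j)) ⟨
  fromℕ (m C j + m C suc j) ⊠ c ^ᶜ (m ∸ j)
    ≡⟨ cong (λ x → fromℕ x ⊠ c ^ᶜ (m ∸ j)) (nCk+nC[k+1]≡[n+1]C[k+1] m j) ⟩
  fromℕ (suc m C suc j) ⊠ c ^ᶜ (m ∸ j) ∎
  where
  P = (X +ₚ const c) ^ₚ m
  -- Truncated subtraction forces two cases: for `m ≤ j` the exponent does not drop, but then the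
  -- binomial coefficient is 0.
  absorb : c ⊠ (fromℕ (m C suc j) ⊠ c ^ᶜ (m ∸ suc j)) ≡ fromℕ (m C suc j) ⊠ c ^ᶜ (m ∸ j)
  absorb = [ absorb-< , absorb-≥ ]′ (<-≤-connex j m)
    where
    absorb-< : j < m → c ⊠ (fromℕ (m C suc j) ⊠ c ^ᶜ (m ∸ suc j)) ≡ fromℕ (m C suc j) ⊠ c ^ᶜ (m ∸ j)
    absorb-< j<m = trans
      (solve 3 (λ c b x → c :* (b :* x) := b :* (c :* x)) refl c (fromℕ (m C suc j)) (c ^ᶜ (m ∸ suc j)))
      (cong (λ e → fromℕ (m C suc j) ⊠ c ^ᶜ e) (suc[m∸1+j]≡m∸j j<m))
    absorb-≥ : m ≤ j → c ⊠ (fromℕ (m C suc j) ⊠ c ^ᶜ (m ∸ suc j)) ≡ fromℕ (m C suc j) ⊠ c ^ᶜ (m ∸ j)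
    absorb-≥ m≤j = subst
      (λ b → c ⊠ (fromℕ b ⊠ c ^ᶜ (m ∸ suc j)) ≡ fromℕ b ⊠ c ^ᶜ (m ∸ j))
      (sym (k>n⇒nCk≡0 (s≤s m≤j)))
      (solve 3 (λ c x y → c :* (con 0# :* x) := con 0# :* y) refl c (c ^ᶜ (m ∸ suc j)) (c ^ᶜ (m ∸ j)))

shift : ℕ → (ℕ → ℚ[i]) → ℕ → ℚ[i]
shift zero    f j       = f j
shift (suc k) f zero    = 0#
shift (suc k) f (suc j) = shift k f j

coeff-X*ₚ : ∀ p → coeff (X *ₚ p) ≗ shift 1 (coeff p)
coeff-X*ₚ p zero    = trans (coeff-*ₚ X p 0) (ℂ.zeroˡ (coeff p 0))
coeff-X*ₚ p (suc j) = trans (coeff-*ₚ X p (suc j))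
  (trans (cong₂ _⊞_ (ℂ.zeroˡ (coeff p (suc j))) (conv-1 (coeff p) j)) (ℂ.+-identityˡ (coeff p j)))

conv-shift : ∀ f g → conv (shift 1 f) g ≗ shift 1 (conv f g)
conv-shift f g zero    = ℂ.zeroˡ (g 0)
conv-shift f g (suc j) = trans (cong (_⊞ conv f g j) (ℂ.zeroˡ (g (suc j)))) (ℂ.+-identityˡ (conv f g j))

shift-suc : ∀ k f → shift 1 (shift k f) ≗ shift (suc k) f
shift-suc k f zero    = refl
shift-suc k f (suc j) = refl

shift-cong : ∀ k {f g} → f ≗ g → shift k f ≗ shift k g
shift-cong zero    f≗g j       = f≗g j
shift-cong (suc k) f≗g zero    = refl
shift-cong (suc k) f≗g (suc j) = shift-cong k f≗g j

coeff-X^*ₚ : ∀ k p → coeff (X ^ₚ k *ₚ p) ≗ shift k (coeff p)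
coeff-X^*ₚ k p j = trans (coeff-*ₚ (X ^ₚ k) p j) (go k j)
  where
  go : ∀ k → conv (coeff (X ^ₚ k)) (coeff p) ≗ shift k (coeff p)
  go zero    j = conv-1 (coeff p) j
  go (suc k) j = begin
    conv (coeff (X *ₚ X ^ₚ k)) (coeff p) j       ≡⟨ conv-congˡ (coeff p) (coeff-X*ₚ (X ^ₚ k)) j ⟩
    conv (shift 1 (coeff (X ^ₚ k))) (coeff p) j  ≡⟨ conv-shift (coeff (X ^ₚ k)) (coeff p) j ⟩
    shift 1 (conv (coeff (X ^ₚ k)) (coeff p)) j  ≡⟨ shift-cong 1 (go k) j ⟩
    shift 1 (shift k (coeff p)) j                ≡⟨ shift-suc k (coeff p) j ⟩
    shift (suc k) (coeff p) j                    ∎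

-- Coefficients of φ_m

ψ : ℕ → ℚ[i]
ψ d = 𝕚 ^ᶜ d ⊞ ⊟ ((⊟ 𝕚) ^ᶜ d)

coeff-φ : ∀ m j → coeff (φ m) j ≡ fromℕ (m C j) ⊠ ψ (m ∸ j)
coeff-φ m j = begin
  coeff (φ m) j
    ≡⟨ coeff--ₚ ((X +ₚ const 𝕚) ^ₚ m) ((X -ₚ const 𝕚) ^ₚ m) j ⟩
  coeff ((X +ₚ const 𝕚) ^ₚ m) j ⊞ ⊟ coeff ((X +ₚ const (⊟ 𝕚)) ^ₚ m) j
    ≡⟨ cong₂ (λ x y → x ⊞ ⊟ y) (coeff-[X+c]^ₚ 𝕚 m j) (coeff-[X+c]^ₚ (⊟ 𝕚) m j) ⟩
  b ⊠ 𝕚 ^ᶜ (m ∸ j) ⊞ ⊟ (b ⊠ (⊟ 𝕚) ^ᶜ (m ∸ j))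
    ≡⟨ solve 3 (λ b x y → b :* x :+ :- (b :* y) := b :* (x :+ :- y)) refl b (𝕚 ^ᶜ (m ∸ j)) ((⊟ 𝕚) ^ᶜ (m ∸ j)) ⟩
  b ⊠ ψ (m ∸ j) ∎
  where b = fromℕ (m C j)

w : ℕ → ℤ
w 0             = -[1+ 1 ]
w 1             = + 0
w (suc (suc s)) = -1ℤ ℤ.* w s

-- Both i and -i have square -1, so raising the exponent by 2 only flips the sign.
𝕚⊠ψ : ∀ s → 𝕚 ⊠ ψ (suc s) ≡ ι (w s)
𝕚⊠ψ 0             = refl
𝕚⊠ψ 1             = refl
𝕚⊠ψ (suc (suc s)) = begin
  𝕚 ⊠ (𝕚 ⊠ (𝕚 ⊠ x) ⊞ ⊟ (⊟ 𝕚 ⊠ (⊟ 𝕚 ⊠ y)))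
    ≡⟨ solve 3 (λ u x y → u :* (u :* (u :* x) :+ :- (:- u :* (:- u :* y))) := (u :* u) :* (u :* (x :+ :- y))) refl 𝕚 x y ⟩
  ι -1ℤ ⊠ (𝕚 ⊠ ψ (suc s))
    ≡⟨ cong (ι -1ℤ ⊠_) (𝕚⊠ψ s) ⟩
  ι -1ℤ ⊠ ι (w s)
    ≡⟨ ι-* -1ℤ (w s) ⟨
  ι (-1ℤ ℤ.* w s) ∎
  where
  x = 𝕚 ^ᶜ suc s
  y = (⊟ 𝕚) ^ᶜ suc s

-- The top terms of (x+i)^m and (x-i)^m cancel, so even x^m has coefficient 0 in `φ m`. Truncated
-- subtraction sends this degree and all larger ones to `ψ 0`, which is 0.
shift-φ-large : ∀ k m j → k + m ≤ j → shift k (coeff (φ m)) j ≡ 0#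
shift-φ-large zero    m j       m≤j       = begin
  coeff (φ m) j               ≡⟨ coeff-φ m j ⟩
  fromℕ (m C j) ⊠ ψ (m ∸ j)   ≡⟨ cong (λ d → fromℕ (m C j) ⊠ ψ d) (m≤n⇒m∸n≡0 m≤j) ⟩
  fromℕ (m C j) ⊠ 0#          ≡⟨ ℂ.zeroʳ (fromℕ (m C j)) ⟩
  0# ∎
shift-φ-large (suc k) m (suc j) (s≤s k+m≤j) = shift-φ-large k m j k+m≤j

-- The power of i in this coefficient has exponent m - (j - k) = s + 1, independent of k. Reflecting
-- C(m, j - k) to C(m, s + 1) removes j and k from the binomial coefficient too.
𝕚⊠shift-φ : ∀ k j s {m n} → k + m ≡ suc n → j + s ≡ n →
            𝕚 ⊠ shift k (coeff (φ m)) j ≡ fromℕ (m C suc s) ⊠ ι (w s)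
𝕚⊠shift-φ zero j s refl refl = begin
  𝕚 ⊠ coeff (φ m) j
    ≡⟨ cong (𝕚 ⊠_) (coeff-φ m j) ⟩
  𝕚 ⊠ (fromℕ (m C j) ⊠ ψ (m ∸ j))
    ≡⟨ cong₂ (λ b d → 𝕚 ⊠ (fromℕ b ⊠ ψ d)) (trans (nCk≡nC[n∸k] j≤m) (cong (m C_) m∸j≡1+s)) m∸j≡1+s ⟩
  𝕚 ⊠ (fromℕ (m C suc s) ⊠ ψ (suc s))
    ≡⟨ solve 3 (λ u b x → u :* (b :* x) := b :* (u :* x)) refl 𝕚 (fromℕ (m C suc s)) (ψ (suc s)) ⟩
  fromℕ (m C suc s) ⊠ (𝕚 ⊠ ψ (suc s))
    ≡⟨ cong (fromℕ (m C suc s) ⊠_) (𝕚⊠ψ s) ⟩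
  fromℕ (m C suc s) ⊠ ι (w s) ∎
  where
  m = suc (j + s)
  j≤m : j ≤ m
  j≤m = ≤-trans (m≤m+n j s) (n≤1+n _)
  m∸j≡1+s : m ∸ j ≡ suc s
  m∸j≡1+s = trans (cong (_∸ j) (sym (+-suc j s))) (m+n∸m≡n j (suc s))
-- Below degree k both sides vanish: the shift gives 0, and the hypotheses force m ≤ s.
𝕚⊠shift-φ (suc k) zero s {m} k+m≡n refl = sym $
  trans (cong (λ b → fromℕ b ⊠ ι (w s)) (k>n⇒nCk≡0 m<1+s)) (ℂ.zeroˡ (ι (w s)))
  where
  m<1+s : m < suc s
  m<1+s = s≤s (subst (m ≤_) (suc-injective k+m≡n) (m≤n+m m k))
𝕚⊠shift-φ (suc k) (suc j) s k+m≡n refl = 𝕚⊠shift-φ k j s (suc-injective k+m≡n) refl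

-- Partial sums of the closed formula

∑ : ℕ → (ℕ → ℕ) → ℕ
∑ zero    f = 0
∑ (suc n) f = ∑ n f + f n

-- summand n is the local function term of A₂, and bracket n (n ∸ 1) the bracket
-- in its closed formula.
summand : ℕ → ℕ → Poly
summand n j = let k = suc (suc j) in
  (1/ (k * suc j)) ·ₚ (X ^ₚ k *ₚ φ (n ∸ k + 1))

bracket : ℕ → ℕ → Poly
bracket n N = X *ₚ φ n -ₚ sumₚ (map (summand n) (upTo N))

coeff-sumₚ-∷ʳ : ∀ ps p j → coeff (sumₚ (ps ∷ʳ p)) j ≡ coeff (sumₚ ps) j ⊞ coeff p j
coeff-sumₚ-∷ʳ []       p j = trans (coeff-+ₚ p [] j) (trans (ℂ.+-identityʳ (coeff p j)) (sym (ℂ.+-identityˡ (coeff p j))))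
coeff-sumₚ-∷ʳ (q ∷ ps) p j = begin
  coeff (q +ₚ sumₚ (ps ∷ʳ p)) j
    ≡⟨ coeff-+ₚ q (sumₚ (ps ∷ʳ p)) j ⟩
  coeff q j ⊞ coeff (sumₚ (ps ∷ʳ p)) j
    ≡⟨ cong (coeff q j ⊞_) (coeff-sumₚ-∷ʳ ps p j) ⟩
  coeff q j ⊞ (coeff (sumₚ ps) j ⊞ coeff p j)
    ≡⟨ solve 3 (λ a b c → a :+ (b :+ c) := (a :+ b) :+ c) refl (coeff q j) (coeff (sumₚ ps) j) (coeff p j) ⟩
  coeff q j ⊞ coeff (sumₚ ps) j ⊞ coeff p j
    ≡⟨ cong (_⊞ coeff p j) (coeff-+ₚ q (sumₚ ps) j) ⟨
  coeff (q +ₚ sumₚ ps) j ⊞ coeff p j ∎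

bracket-zero : ∀ n j → coeff (bracket n 0) j ≡ shift 1 (coeff (φ n)) j
bracket-zero n j = begin
  coeff (bracket n 0) j                ≡⟨ coeff--ₚ (X *ₚ φ n) [] j ⟩
  coeff (X *ₚ φ n) j ⊞ ⊟ 0#         ≡⟨ ℂ.+-identityʳ (coeff (X *ₚ φ n) j) ⟩
  coeff (X *ₚ φ n) j                ≡⟨ coeff-X*ₚ (φ n) j ⟩
  shift 1 (coeff (φ n)) j           ∎

bracket-suc : ∀ n N j → coeff (bracket n (suc N)) j ≡
  coeff (bracket n N) j ⊞ ⊟ ((1/ (suc (suc N) * suc N)) ⊠ shift (suc (suc N)) (coeff (φ (n ∸ suc (suc N) + 1))) j)
bracket-suc n N j = begin
  coeff (bracket n (suc N)) j
    ≡⟨ coeff--ₚ (X *ₚ φ n) (sumₚ (map (summand n) (upTo (suc N)))) j ⟩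
  x ⊞ ⊟ coeff (sumₚ (map (summand n) (upTo (suc N)))) j
    ≡⟨ cong (λ l → x ⊞ ⊟ coeff (sumₚ l) j) (trans (cong (map (summand n)) (sym (upTo-∷ʳ N))) (map-++ (summand n) (upTo N) (N ∷ []))) ⟩
  x ⊞ ⊟ coeff (sumₚ (map (summand n) (upTo N) ∷ʳ summand n N)) j
    ≡⟨ cong (λ y → x ⊞ ⊟ y) (coeff-sumₚ-∷ʳ (map (summand n) (upTo N)) (summand n N) j) ⟩
  x ⊞ ⊟ (y ⊞ coeff (summand n N) j)
    ≡⟨ solve 3 (λ x y z → x :+ :- (y :+ z) := x :+ :- y :+ :- z) refl x y (coeff (summand n N) j) ⟩
  x ⊞ ⊟ y ⊞ ⊟ coeff (summand n N) j
    ≡⟨ cong₂ (λ u v → u ⊞ ⊟ v) (sym (coeff--ₚ (X *ₚ φ n) (sumₚ (map (summand n) (upTo N))) j))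
         (trans (coeff-·ₚ c (X ^ₚ k *ₚ p) j) (cong (c ⊠_) (coeff-X^*ₚ k p j))) ⟩
  coeff (bracket n N) j ⊞ ⊟ (c ⊠ shift k (coeff p) j) ∎
  where
  k = suc (suc N)
  p = φ (n ∸ k + 1)
  c = 1/ (k * suc N)
  x = coeff (X *ₚ φ n) j
  y = coeff (sumₚ (map (summand n) (upTo N))) j

-- Integrality by coefficients, and summation by parts

coeff-integer : ∀ {p} → Integral p → ∀ j → IsInteger (coeff p j)
coeff-integer []       j       = + 0 , refl
coeff-integer (a ∷ as) zero    = a
coeff-integer (a ∷ as) (suc j) = coeff-integer as j

integral : ∀ p → (∀ j → IsInteger (coeff p j)) → Integral p
integral []      h = []
integral (a ∷ p) h = h 0 ∷ integral p (h ∘ suc)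

-- Divisibility ignores signs; the absolute values of `w` keep all later sums in ℕ.
weight : ℕ → ℕ
weight 0             = 2
weight 1             = 0
weight (suc (suc s)) = weight s

∣w∣≡weight : ∀ s → ℤ.∣ w s ∣ ≡ weight s
∣w∣≡weight 0             = refl
∣w∣≡weight 1             = refl
∣w∣≡weight (suc (suc s)) = trans (ℤ.abs-* -1ℤ (w s)) (trans (*-identityˡ ℤ.∣ w s ∣) (∣w∣≡weight s))

-- The exponents in x^k φ_(n-k+1) have a constant sum. At a fixed j all terms therefore carry the
-- same power of i, and `w s` factors out.
index-sum : ∀ {n N} → N < n → suc (suc N) + (suc n ∸ suc (suc N) + 1) ≡ suc (suc n)
index-sum {n} {N} N<n = cong (λ x → suc (suc x)) (begin
  N + (n ∸ suc N + 1)   ≡⟨ cong (N ℕ.+_) (trans (+-comm (n ∸ suc N) 1) (suc[m∸1+j]≡m∸j N<n)) ⟩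
  N + (n ∸ N)           ≡⟨ m+[n∸m]≡n (<⇒≤ N<n) ⟩
  n                     ∎)

-- Y k stands for L / (k + 1).
module _ (n L : ℕ) (Y : ℕ → ℕ) (Y-spec : ∀ k → k ≤ n → suc k * Y k ≡ L) where

  -- The telescoping identity written without subtraction. Multiplied by (N+2)(N+1) it reads L +
  -- (N+1)·L = (N+2)·L.
  L/k[k+1] : ∀ N → suc N ≤ n → fromℕ L ⊠ (1/ (suc (suc N) * suc N)) ⊞ fromℕ (Y (suc N)) ≡ fromℕ (Y N)
  L/k[k+1] N N<n = begin
    fromℕ L ⊠ r ⊞ b                     ≡⟨ cong (fromℕ L ⊠ r ⊞_) (ℂ.*-identityʳ b) ⟨
    fromℕ L ⊠ r ⊞ b ⊠ 1#                ≡⟨ cong (λ x → fromℕ L ⊠ r ⊞ b ⊠ x) (d⊠1/d≡1 D) ⟨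
    fromℕ L ⊠ r ⊞ b ⊠ (fromℕ D ⊠ r)     ≡⟨ solve 4 (λ l r b d → l :* r :+ b :* (d :* r) := (l :+ b :* d) :* r) refl (fromℕ L) r b (fromℕ D) ⟩
    (fromℕ L ⊞ b ⊠ fromℕ D) ⊠ r         ≡⟨ cong (λ x → (fromℕ L ⊞ x) ⊠ r) (ι⁺-* (Y (suc N)) D) ⟨
    (fromℕ L ⊞ fromℕ (Y (suc N) * D)) ⊠ r ≡⟨ cong (_⊠ r) (ι⁺-+ L (Y (suc N) * D)) ⟨
    fromℕ (L + Y (suc N) * D) ⊠ r       ≡⟨ cong (λ x → fromℕ x ⊠ r) key ⟩
    fromℕ (Y N * D) ⊠ r                 ≡⟨ cong (_⊠ r) (ι⁺-* (Y N) D) ⟩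
    fromℕ (Y N) ⊠ fromℕ D ⊠ r           ≡⟨ ℂ.*-assoc (fromℕ (Y N)) (fromℕ D) r ⟩
    fromℕ (Y N) ⊠ (fromℕ D ⊠ r)         ≡⟨ cong (fromℕ (Y N) ⊠_) (d⊠1/d≡1 D) ⟩
    fromℕ (Y N) ⊠ 1#                    ≡⟨ ℂ.*-identityʳ (fromℕ (Y N)) ⟩
    fromℕ (Y N)                         ∎
    where
    D = suc (suc N) * suc N
    r = 1/ D
    b = fromℕ (Y (suc N))
    rearrange : ∀ a x → x * (suc (suc a) * suc a) ≡ suc a * (suc (suc a) * x)
    rearrange = solve-∀
    rearrange′ : ∀ a x → x * (suc (suc a) * suc a) ≡ suc (suc a) * (suc a * x)
    rearrange′ = solve-∀
    key : L + Y (suc N) * D ≡ Y N * D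
    key = begin
      L + Y (suc N) * D                        ≡⟨ cong (L ℕ.+_) (rearrange N (Y (suc N))) ⟩
      L + suc N * (suc (suc N) * Y (suc N))    ≡⟨ cong (λ l → L + suc N * l) (Y-spec (suc N) N<n) ⟩
      suc (suc N) * L                          ≡⟨ cong (suc (suc N) *_) (Y-spec N (<⇒≤ N<n)) ⟨
      suc (suc N) * (suc N * Y N)              ≡⟨ rearrange′ N (Y N) ⟨
      Y N * D ∎

  Z : ℕ → ℕ
  Z s = ∑ (suc n) λ k → ((n ∸ k) C s) * Y k

  -- The last product is the boundary term of the summation by parts. The next summand subtracts
  -- C(n-N, s+1)·(Y N - Y (N+1)), which turns `Y N` in the boundary term into `Y (suc N)`; Pascal's
  -- rule then splits it into a new term of the sum and the new boundary term.
  bracket-formula : ∀ {j s} → j + s ≡ suc n → ∀ N → N ≤ n →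
    𝕚 ⊠ (fromℕ L ⊠ coeff (bracket (suc n) N) j) ≡
    ι (w s) ⊠ fromℕ (∑ (suc N) (λ k → ((n ∸ k) C s) * Y k) + ((n ∸ N) C suc s) * Y N)
  bracket-formula {j} {s} eq zero _ = begin
    𝕚 ⊠ (fromℕ L ⊠ coeff (bracket (suc n) 0) j)
      ≡⟨ cong (λ x → 𝕚 ⊠ (fromℕ L ⊠ x)) (bracket-zero (suc n) j) ⟩
    𝕚 ⊠ (fromℕ L ⊠ shift 1 (coeff (φ (suc n))) j)
      ≡⟨ solve 3 (λ u l x → u :* (l :* x) := l :* (u :* x)) refl 𝕚 (fromℕ L) (shift 1 (coeff (φ (suc n))) j) ⟩
    fromℕ L ⊠ (𝕚 ⊠ shift 1 (coeff (φ (suc n))) j)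
      ≡⟨ cong (fromℕ L ⊠_) (𝕚⊠shift-φ 1 j s refl eq) ⟩
    fromℕ L ⊠ (fromℕ (suc n C suc s) ⊠ ι (w s))
      ≡⟨ solve 3 (λ l b x → l :* (b :* x) := x :* (b :* l)) refl (fromℕ L) (fromℕ (suc n C suc s)) (ι (w s)) ⟩
    ι (w s) ⊠ (fromℕ (suc n C suc s) ⊠ fromℕ L)
      ≡⟨ cong (ι (w s) ⊠_) (ι⁺-* (suc n C suc s) L) ⟨
    ι (w s) ⊠ fromℕ ((suc n C suc s) * L)
      ≡⟨ cong (λ x → ι (w s) ⊠ fromℕ x) (trans
           (cong₂ _*_ (sym (nCk+nC[k+1]≡[n+1]C[k+1] n s)) (trans (sym (Y-spec 0 z≤n)) (*-identityˡ (Y 0))))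
           (*-distribʳ-+ (Y 0) (n C s) (n C suc s))) ⟩
    ι (w s) ⊠ fromℕ ((n C s) * Y 0 + (n C suc s) * Y 0) ∎
  bracket-formula {j} {s} eq (suc N) N<n = begin
    𝕚 ⊠ (fromℕ L ⊠ coeff (bracket (suc n) (suc N)) j)
      ≡⟨ cong (λ x → 𝕚 ⊠ (fromℕ L ⊠ x)) (bracket-suc (suc n) N j) ⟩
    𝕚 ⊠ (fromℕ L ⊠ (coeff (bracket (suc n) N) j ⊞ ⊟ (r ⊠ t)))
      ≡⟨ solve 5 (λ u l x r t → u :* (l :* (x :+ :- (r :* t))) := u :* (l :* x) :+ :- (l :* r :* (u :* t)))
           refl 𝕚 (fromℕ L) (coeff (bracket (suc n) N) j) r t ⟩
    𝕚 ⊠ (fromℕ L ⊠ coeff (bracket (suc n) N) j) ⊞ ⊟ (fromℕ L ⊠ r ⊠ (𝕚 ⊠ t))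
      ≡⟨ cong₂ (λ x y → x ⊞ ⊟ (fromℕ L ⊠ r ⊠ y)) (bracket-formula eq N (<⇒≤ N<n)) (𝕚⊠shift-φ (suc (suc N)) j s (index-sum N<n) eq) ⟩
    ι (w s) ⊠ fromℕ (S + c * Y N) ⊞ ⊟ (fromℕ L ⊠ r ⊠ (fromℕ (m C suc s) ⊠ ι (w s)))
      ≡⟨ cong₂ (λ x b → ι (w s) ⊠ x ⊞ ⊟ (fromℕ L ⊠ r ⊠ (fromℕ b ⊠ ι (w s)))) expand (cong (_C suc s) m≡n∸N) ⟩
    ι (w s) ⊠ (fromℕ S ⊞ fromℕ c ⊠ fromℕ (Y N)) ⊞ ⊟ (fromℕ L ⊠ r ⊠ (fromℕ c ⊠ ι (w s)))
      ≡⟨ cong (λ y → ι (w s) ⊠ (fromℕ S ⊞ fromℕ c ⊠ y) ⊞ ⊟ (fromℕ L ⊠ r ⊠ (fromℕ c ⊠ ι (w s)))) (sym (L/k[k+1] N N<n)) ⟩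
    ι (w s) ⊠ (fromℕ S ⊞ fromℕ c ⊠ (fromℕ L ⊠ r ⊞ fromℕ y)) ⊞ ⊟ (fromℕ L ⊠ r ⊠ (fromℕ c ⊠ ι (w s)))
      ≡⟨ solve 5 (λ w s c z y → w :* (s :+ c :* (z :+ y)) :+ :- (z :* (c :* w)) := w :* (s :+ c :* y))
           refl (ι (w s)) (fromℕ S) (fromℕ c) (fromℕ L ⊠ r) (fromℕ y) ⟩
    ι (w s) ⊠ (fromℕ S ⊞ fromℕ c ⊠ fromℕ y)
      ≡⟨ cong (ι (w s) ⊠_) (trans (cong (fromℕ S ⊞_) (sym (ι⁺-* c y))) (sym (ι⁺-+ S (c * y)))) ⟩
    ι (w s) ⊠ fromℕ (S + c * y)
      ≡⟨ cong (λ x → ι (w s) ⊠ fromℕ x) pascal ⟩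
    ι (w s) ⊠ fromℕ (S + ((n ∸ suc N) C s) * y + ((n ∸ suc N) C suc s) * y) ∎
    where
    m = suc n ∸ suc (suc N) + 1
    r = 1/ (suc (suc N) * suc N)
    t = shift (suc (suc N)) (coeff (φ m)) j
    S = ∑ (suc N) λ k → ((n ∸ k) C s) * Y k
    c = (n ∸ N) C suc s
    y = Y (suc N)
    1+[n∸1+N] : suc (n ∸ suc N) ≡ n ∸ N
    1+[n∸1+N] = suc[m∸1+j]≡m∸j N<n
    m≡n∸N : m ≡ n ∸ N
    m≡n∸N = trans (+-comm (n ∸ suc N) 1) 1+[n∸1+N]
    expand : fromℕ (S + c * Y N) ≡ fromℕ S ⊞ fromℕ c ⊠ fromℕ (Y N)
    expand = trans (ι⁺-+ S (c * Y N)) (cong (fromℕ S ⊞_) (ι⁺-* c (Y N)))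
    pascal : S + c * y ≡ S + ((n ∸ suc N) C s) * y + ((n ∸ suc N) C suc s) * y
    pascal = begin
      S + c * y
        ≡⟨ cong (λ a → S + (a C suc s) * y) 1+[n∸1+N] ⟨
      S + (suc (n ∸ suc N) C suc s) * y
        ≡⟨ cong (λ a → S + a * y) (nCk+nC[k+1]≡[n+1]C[k+1] (n ∸ suc N) s) ⟨
      S + ((n ∸ suc N) C s + (n ∸ suc N) C suc s) * y
        ≡⟨ cong (S ℕ.+_) (*-distribʳ-+ y ((n ∸ suc N) C s) _) ⟩
      S + (((n ∸ suc N) C s) * y + ((n ∸ suc N) C suc s) * y)
        ≡⟨ +-assoc S _ _ ⟨
      S + ((n ∸ suc N) C s) * y + ((n ∸ suc N) C suc s) * y ∎

  n!L : ℕ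
  n!L = suc n ! * L

  coeff-A₂ : ∀ {j s} → j + s ≡ suc n → fromℕ n!L ⊠ coeff (A₂ (suc n)) j ≡ ι (w s ℤ.* + Z s)
  coeff-A₂ {j} {s} eq = begin
    fromℕ n!L ⊠ coeff (A₂ (suc n)) j
      ≡⟨ cong₂ _⊠_ (ι⁺-* (suc n !) L) (coeff-·ₚ (𝕚 ⊠ r) (bracket (suc n) n) j) ⟩
    fromℕ (suc n !) ⊠ fromℕ L ⊠ (𝕚 ⊠ r ⊠ coeff (bracket (suc n) n) j)
      ≡⟨ solve 5 (λ f l u r x → f :* l :* (u :* r :* x) := f :* r :* (u :* (l :* x)))
           refl (fromℕ (suc n !)) (fromℕ L) 𝕚 r (coeff (bracket (suc n) n) j) ⟩
    fromℕ (suc n !) ⊠ r ⊠ (𝕚 ⊠ (fromℕ L ⊠ coeff (bracket (suc n) n) j))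
      ≡⟨ cong₂ _⊠_ (d⊠1/d≡1 (suc n !) {{suc n !≢0}}) (bracket-formula eq n ≤-refl) ⟩
    1# ⊠ (ι (w s) ⊠ fromℕ (Z s + ((n ∸ n) C suc s) * Y n))
      ≡⟨ ℂ.*-identityˡ (ι (w s) ⊠ fromℕ (Z s + ((n ∸ n) C suc s) * Y n)) ⟩
    ι (w s) ⊠ fromℕ (Z s + ((n ∸ n) C suc s) * Y n)
      -- The boundary term ends with C(0, s+1) = 0.
      ≡⟨ cong (λ x → ι (w s) ⊠ fromℕ x) (trans (cong (λ a → Z s + (a C suc s) * Y n) (n∸n≡0 n)) (+-identityʳ (Z s))) ⟩
    ι (w s) ⊠ fromℕ (Z s)
      ≡⟨ ι-* (w s) (+ Z s) ⟨
    ι (w s ℤ.* + Z s) ∎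
    where
    r : ℚ[i]
    r = (1/ (suc n !)) {{suc n !≢0}}

  bracket-large : ∀ N j → N ≤ n → suc n < j → coeff (bracket (suc n) N) j ≡ 0#
  bracket-large zero    j _   n<j = trans (bracket-zero (suc n) j) (shift-φ-large 1 (suc n) j n<j)
  bracket-large (suc N) j N<n n<j = begin
    coeff (bracket (suc n) (suc N)) j
      ≡⟨ bracket-suc (suc n) N j ⟩
    coeff (bracket (suc n) N) j ⊞ ⊟ (r ⊠ shift (suc (suc N)) (coeff (φ m)) j)
      ≡⟨ cong₂ (λ x y → x ⊞ ⊟ (r ⊠ y)) (bracket-large N j (<⇒≤ N<n) n<j)
           (shift-φ-large (suc (suc N)) m j (subst (_≤ j) (sym (index-sum N<n)) n<j)) ⟩
    0# ⊞ ⊟ (r ⊠ 0#)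
      ≡⟨ solve 1 (λ r → con 0# :+ :- (r :* con 0#) := con 0#) refl r ⟩
    0# ∎
    where
    m = suc n ∸ suc (suc N) + 1
    r = 1/ (suc (suc N) * suc N)

  coeff-A₂-large : ∀ j → suc n < j → coeff (A₂ (suc n)) j ≡ 0#
  coeff-A₂-large j n<j = begin
    coeff (A₂ (suc n)) j              ≡⟨ coeff-·ₚ (𝕚 ⊠ r) (bracket (suc n) n) j ⟩
    𝕚 ⊠ r ⊠ coeff (bracket (suc n) n) j  ≡⟨ cong (𝕚 ⊠ r ⊠_) (bracket-large n j ≤-refl n<j) ⟩
    𝕚 ⊠ r ⊠ 0#                        ≡⟨ ℂ.zeroʳ (𝕚 ⊠ r) ⟩
    0#                                ∎
    where
    r : ℚ[i]
    r = (1/ (suc n !)) {{suc n !≢0}}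

  module _ .{{_ : NonZero n!L}} where

    -- n!·L is invertible in ℚ(i), so d·c = k is equivalent to d·z = n!·L·k, an equation between
    -- integers.
    integer⇔∣ : ∀ d c z → fromℕ n!L ⊠ c ≡ ι z → IsInteger (fromℕ d ⊠ c) ⇔ n!L ∣ d * ℤ.∣ z ∣
    integer⇔∣ d c z eq = mk⇔ to from
      where
      cleared : fromℕ n!L ⊠ (fromℕ d ⊠ c) ≡ ι (+ d ℤ.* z)
      cleared = begin
        fromℕ n!L ⊠ (fromℕ d ⊠ c)   ≡⟨ solve 3 (λ a b c → a :* (b :* c) := b :* (a :* c)) refl (fromℕ n!L) (fromℕ d) c ⟩
        fromℕ d ⊠ (fromℕ n!L ⊠ c)   ≡⟨ cong (fromℕ d ⊠_) eq ⟩
        fromℕ d ⊠ ι z               ≡⟨ ι-* (+ d) z ⟨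
        ι (+ d ℤ.* z)               ∎
      to : IsInteger (fromℕ d ⊠ c) → n!L ∣ d * ℤ.∣ z ∣
      to (k , dc≡k) = divides ℤ.∣ k ∣ (begin
        d * ℤ.∣ z ∣              ≡⟨ ℤ.abs-* (+ d) z ⟨
        ℤ.∣ + d ℤ.* z ∣          ≡⟨ cong ℤ.∣_∣ (ι-injective {+ d ℤ.* z} {+ n!L ℤ.* k} (trans (sym cleared) (trans (cong (fromℕ n!L ⊠_) dc≡k) (sym (ι-* (+ n!L) k))))) ⟩
        ℤ.∣ + n!L ℤ.* k ∣        ≡⟨ ℤ.abs-* (+ n!L) k ⟩
        n!L * ℤ.∣ k ∣            ≡⟨ *-comm n!L ℤ.∣ k ∣ ⟩
        ℤ.∣ k ∣ * n!L            ∎)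
      from : n!L ∣ d * ℤ.∣ z ∣ → IsInteger (fromℕ d ⊠ c)
      from N∣dz = q , (begin
        fromℕ d ⊠ c                                ≡⟨ ℂ.*-identityˡ (fromℕ d ⊠ c) ⟨
        1# ⊠ (fromℕ d ⊠ c)                         ≡⟨ cong (_⊠ (fromℕ d ⊠ c)) (d⊠1/d≡1 n!L) ⟨
        fromℕ n!L ⊠ r ⊠ (fromℕ d ⊠ c)              ≡⟨ solve 3 (λ a b c → a :* b :* c := b :* (a :* c)) refl (fromℕ n!L) r (fromℕ d ⊠ c) ⟩
        r ⊠ (fromℕ n!L ⊠ (fromℕ d ⊠ c))            ≡⟨ cong (r ⊠_) cleared ⟩
        r ⊠ ι (+ d ℤ.* z)                          ≡⟨ cong (λ x → r ⊠ ι x) (ℤ._∣_.equality N∣ₛdz) ⟩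
        r ⊠ ι (q ℤ.* + n!L)                        ≡⟨ cong (r ⊠_) (ι-* q (+ n!L)) ⟩
        r ⊠ (ι q ⊠ fromℕ n!L)                      ≡⟨ solve 3 (λ a b c → a :* (b :* c) := (c :* a) :* b) refl r (ι q) (fromℕ n!L) ⟩
        (fromℕ n!L ⊠ r) ⊠ ι q                      ≡⟨ cong (_⊠ ι q) (d⊠1/d≡1 n!L) ⟩
        1# ⊠ ι q                                   ≡⟨ ℂ.*-identityˡ (ι q) ⟩
        ι q                                        ∎)
        where
        r = 1/ n!L
        N∣ₛdz : + n!L ℤ.∣ + d ℤ.* z
        N∣ₛdz = ℤ.∣ᵤ⇒∣ (subst (n!L ∣_) (sym (ℤ.abs-* (+ d) z)) N∣dz)
        q = ℤ._∣_.quotient N∣ₛdz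

    ∣wZ∣ : ∀ s → ℤ.∣ w s ℤ.* + Z s ∣ ≡ weight s * Z s
    ∣wZ∣ s = trans (ℤ.abs-* (w s) (+ Z s)) (cong (_* Z s) (∣w∣≡weight s))

    open Equivalence

    -- Coefficients beyond x^(n+1) vanish, so finitely many conditions remain, indexed by s = n + 1
    -- - j.
    integral⇔∣ : ∀ d → Integral (fromℕ d ·ₚ A₂ (suc n)) ⇔ (∀ s → s ≤ suc n → n!L ∣ d * (weight s * Z s))
    integral⇔∣ d = mk⇔ only-if if
      where
      A = A₂ (suc n)
      only-if : Integral (fromℕ d ·ₚ A) → ∀ s → s ≤ suc n → n!L ∣ d * (weight s * Z s)
      only-if h s s≤n = subst (λ x → n!L ∣ d * x) (∣wZ∣ s) $
        to (integer⇔∣ d (coeff A j) (w s ℤ.* + Z s) (coeff-A₂ (m∸n+n≡m s≤n)))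
           (subst IsInteger (coeff-·ₚ (fromℕ d) A j) (coeff-integer h j))
        where j = suc n ∸ s
      if : (∀ s → s ≤ suc n → n!L ∣ d * (weight s * Z s)) → Integral (fromℕ d ·ₚ A)
      if h = integral (fromℕ d ·ₚ A) λ j → subst IsInteger (sym (coeff-·ₚ (fromℕ d) A j))
        ([ small j , large j ]′ (≤-<-connex j (suc n)))
        where
        small : ∀ j → j ≤ suc n → IsInteger (fromℕ d ⊠ coeff A j)
        small j j≤n = from (integer⇔∣ d (coeff A j) (w s ℤ.* + Z s) (coeff-A₂ (m+[n∸m]≡n j≤n)))
          (subst (λ x → n!L ∣ d * x) (sym (∣wZ∣ s)) (h s (m∸n≤m (suc n) j)))
          where s = suc n ∸ j
        large : ∀ j → suc n < j → IsInteger (fromℕ d ⊠ coeff A j)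
        large j n<j = + 0 , trans (cong (fromℕ d ⊠_) (coeff-A₂-large j n<j)) (ℂ.zeroʳ (fromℕ d))

-- Powers of 3

prime[3] : Prime 3
prime[3] = from-yes (prime? 3)

3∤* : ∀ m n → 3 ∤ m → 3 ∤ n → 3 ∤ m * n
3∤* m n 3∤m 3∤n 3∣mn = [ 3∤m , 3∤n ]′ (euclidsLemma m n prime[3] 3∣mn)

-- Euclid's lemma strips the factors 3 from m one at a time.
3^∣*⇒3^∣ : ∀ e {m n} → 3 ∤ n → 3 ^ e ∣ m * n → 3 ^ e ∣ m
3^∣*⇒3^∣ zero    {m}     3∤n _       = 1∣ m
3^∣*⇒3^∣ (suc e) {m} {n} 3∤n 3^e∣mn
  with euclidsLemma m n prime[3] (m*n∣⇒m∣ 3 (3 ^ e) 3^e∣mn)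
... | inj₂ 3∣n              = contradiction 3∣n 3∤n
... | inj₁ (divides m′ refl) = subst (3 ^ suc e ∣_) (*-comm 3 m′) $ *-monoʳ-∣ 3 $ 3^∣*⇒3^∣ e {m′} 3∤n $
  *-cancelˡ-∣ {n = m′ * n} 3 (subst (3 ^ suc e ∣_) (trans (cong (_* n) (*-comm m′ 3)) (*-assoc 3 m′ n)) 3^e∣mn)

^greatestExponent∣ : ∀ p m b → p ^ greatestExponent p m b ∣ m
^greatestExponent∣ p m zero    = 1∣ m
^greatestExponent∣ p m (suc b) with p ^ suc b ∣? m
... | yes p^b∣m = p^b∣m
... | no  _     = ^greatestExponent∣ p m b

greatestExponent-max : ∀ p m b {e} → e ≤ b → p ^ e ∣ m → e ≤ greatestExponent p m b
greatestExponent-max p m zero    e≤b _     = e≤b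
greatestExponent-max p m (suc b) e≤b p^e∣m with p ^ suc b ∣? m | m≤n⇒m<n∨m≡n e≤b
... | yes _    | _               = e≤b
... | no _     | inj₁ (s≤s e≤b′) = greatestExponent-max p m b e≤b′ p^e∣m
... | no p^b∤m | inj₂ refl       = contradiction p^e∣m p^b∤m

e<3^e : ∀ e → e < 3 ^ e
e<3^e zero    = s≤s z≤n
e<3^e (suc e) = ≤-<-trans (e<3^e e) (^-monoʳ-< 3 (s≤s (s≤s z≤n)) (n<1+n e))

3^ν∣ : ∀ m → 3 ^ ν 3 m ∣ m
3^ν∣ m = ^greatestExponent∣ 3 m m

3^∣⇒≤ν : ∀ m .{{_ : NonZero m}} {e} → 3 ^ e ∣ m → e ≤ ν 3 m
3^∣⇒≤ν m {e} 3^e∣m = greatestExponent-max 3 m m (≤-trans (<⇒≤ (e<3^e e)) (∣⇒≤ 3^e∣m)) 3^e∣m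

ν-≡ : ∀ m n .{{_ : NonZero m}} .{{_ : NonZero n}} →
      (∀ e → 3 ^ e ∣ m → 3 ^ e ∣ n) → (∀ e → 3 ^ e ∣ n → 3 ^ e ∣ m) → ν 3 m ≡ ν 3 n
ν-≡ m n m⇒n n⇒m = ≤-antisym (3^∣⇒≤ν n (m⇒n (ν 3 m) (3^ν∣ m))) (3^∣⇒≤ν m (n⇒m (ν 3 n) (3^ν∣ n)))

ν[3m] : ∀ m .{{_ : NonZero m}} → ν 3 (3 * m) ≡ suc (ν 3 m)
ν[3m] m = ≤-antisym (below (ν 3 (3 * m)) (3^ν∣ (3 * m))) (3^∣⇒≤ν (3 * m) (*-monoʳ-∣ 3 (3^ν∣ m)))
  where
  instance _ = m*n≢0 3 m
  below : ∀ e → 3 ^ e ∣ 3 * m → e ≤ suc (ν 3 m)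
  below zero    _       = z≤n
  below (suc e) 3^e∣3m = s≤s (3^∣⇒≤ν m (*-cancelˡ-∣ 3 3^e∣3m))

3-free-part : ∀ m .{{_ : NonZero m}} → ∃₂ λ a b → m ≡ 3 ^ a * b × 3 ∤ b
3-free-part m with 3^ν∣ m
... | divides b eq = ν 3 m , b , trans eq (*-comm b (3 ^ ν 3 m)) , λ { (divides c refl) →
  1+n≰n (3^∣⇒≤ν m {suc (ν 3 m)} (divides c (trans eq (*-assoc c 3 _)))) }

-- The 3-part of lcm(1, …, n)

∈⇒∣foldr-lcm : ∀ {k ks} → k ∈ ks → k ∣ foldr lcm 1 ks
∈⇒∣foldr-lcm {ks = k ∷ ks} (here refl)  = m∣lcm[m,n] k _
∈⇒∣foldr-lcm {ks = k ∷ ks} (there k∈ks) = ∣-trans (∈⇒∣foldr-lcm k∈ks) (n∣lcm[m,n] k _)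

foldr-lcm-least : ∀ {m ks} → All (_∣ m) ks → foldr lcm 1 ks ∣ m
foldr-lcm-least {m} []         = 1∣ m
foldr-lcm-least     (k∣ ∷ ks∣) = lcm-least k∣ (foldr-lcm-least ks∣)

1+k∣lcmUpTo : ∀ {n k} → k < n → suc k ∣ lcmUpTo n
1+k∣lcmUpTo k<n = ∈⇒∣foldr-lcm (∈-applyUpTo⁺ suc k<n)

3^a∣3^e : ∀ {a e} → a ≤ e → 3 ^ a ∣ 3 ^ e
3^a∣3^e {a} {e} a≤e = subst (3 ^ a ∣_)
  (trans (sym (^-distribˡ-+-* 3 a (e ∸ a))) (cong (3 ^_) (m+[n∸m]≡n a≤e))) (m∣m*n (3 ^ (e ∸ a)))

-- R is the product of the 3-free parts of 1, …, b.
3-free-multiple : ∀ e b → b < 3 ^ suc e → ∃[ R ] 3 ∤ R × (∀ {k} → k < b → suc k ∣ 3 ^ e * R)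
3-free-multiple e zero    _ = 1 , from-no (3 ∣? 1) , λ ()
3-free-multiple e (suc b) b<
  with 3-free-multiple e b (<-trans (n<1+n b) b<) | 3-free-part (suc b)
... | R , 3∤R , div | a , c , eq , 3∤c = R * c , 3∤* R c 3∤R 3∤c , div′
  where
  3^a≤1+b : 3 ^ a ≤ suc b
  3^a≤1+b = ∣⇒≤ (divides c (trans eq (*-comm (3 ^ a) c)))
  a≤e : a ≤ e
  a≤e = ≮⇒≥ λ e<a → <⇒≱ b< (≤-trans (^-monoʳ-≤ 3 e<a) 3^a≤1+b)
  div′ : ∀ {k} → k < suc b → suc k ∣ 3 ^ e * (R * c)
  div′ {k} (s≤s k≤b) with m≤n⇒m<n∨m≡n k≤b
  ... | inj₁ k<b  = subst (suc k ∣_) (*-assoc (3 ^ e) R c) (∣m⇒∣m*n c (div k<b))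
  ... | inj₂ refl = subst (_∣ 3 ^ e * (R * c)) (sym eq) (*-pres-∣ (3^a∣3^e a≤e) (n∣m*n R))

lcmUpTo≢0 : ∀ n → NonZero (lcmUpTo n)
lcmUpTo≢0 n = ≢-nonZero λ lcm≡0 → 
  ≢-nonZero⁻¹ (n !) {{n !≢0}} (0∣⇒≡0 (subst (_∣ n !) lcm≡0 (foldr-lcm-least (applyUpTo⁺₁ suc n 1+k∣n!))))
  where
  1+k∣n! : ∀ {k} → k < n → suc k ∣ n !
  1+k∣n! {k} k<n = ∣-trans (m∣m*n (k !)) (m≤n⇒m!∣n! k<n)

-- The number 3^e is itself among 1, ..., n. Conversely the lcm divides 3^e·R with R prime to 3,
-- which leaves no room for another factor 3.
lcmUpTo-3-part : ∀ e n → 3 ^ e ≤ n → n < 3 ^ suc e → ∃[ M ] lcmUpTo n ≡ 3 ^ e * M × 3 ∤ M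
lcmUpTo-3-part e n 3^e≤n n< with 3-free-multiple e n n<
... | R , 3∤R , div = M , eq , λ { (divides c M≡c*3) → 3∤R (3∣R c (trans eq (cong (3 ^ e *_) M≡c*3))) }
  where
  instance _ = m^n≢0 3 e
  3^e∣ : 3 ^ e ∣ lcmUpTo n
  3^e∣ = subst (_∣ lcmUpTo n) (suc-pred (3 ^ e)) (1+k∣lcmUpTo (subst (_≤ n) (sym (suc-pred (3 ^ e))) 3^e≤n))
  M = quotient 3^e∣
  eq : lcmUpTo n ≡ 3 ^ e * M
  eq = m∣n⇒n≡m*quotient 3^e∣
  3∣R : ∀ c → lcmUpTo n ≡ 3 ^ e * (c * 3) → 3 ∣ R
  3∣R c eq′ = m*n∣⇒n∣ c 3 (*-cancelˡ-∣ (3 ^ e) (subst (_∣ 3 ^ e * R) eq′ (foldr-lcm-least (applyUpTo⁺₁ suc n div))))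

-- The leading base-3 digit decides whether one or two multiples of 3^e lie in the range of
-- summation.
leading-digit : ∀ n → ∃₂ λ e t → t < 3 ^ e × (suc n ≡ 1 * 3 ^ e + t ⊎ suc n ≡ 2 * 3 ^ e + t)
leading-digit zero = 0 , 0 , s≤s z≤n , inj₁ refl
leading-digit (suc n) with leading-digit n
... | e , t , t<q , n≡ with m≤n⇒m<n∨m≡n t<q
...   | inj₁ 1+t<q = e , suc t , 1+t<q , [ inj₁ ∘ next 1 , inj₂ ∘ next 2 ]′ n≡
  where
  next : ∀ c → suc n ≡ c * 3 ^ e + t → suc (suc n) ≡ c * 3 ^ e + suc t
  next c eq = trans (cong suc eq) (sym (+-suc (c * 3 ^ e) t))
-- The remainder overflows: digit 1 becomes 2, and digit 2 carries to a 1 in the next place.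
...   | inj₂ 1+t≡q = [ (λ eq → e , 0 , m^n>0 3 e , inj₂ (carry 1 eq (solve₁ (3 ^ e))))
                     , (λ eq → suc e , 0 , m^n>0 3 (suc e) , inj₁ (carry 2 eq (solve₂ (3 ^ e)))) ]′ n≡
  where
  carry : ∀ c {m} → suc n ≡ c * 3 ^ e + t → c * 3 ^ e + 3 ^ e ≡ m → suc (suc n) ≡ m
  carry c eq eq′ = trans (cong suc eq) (trans (sym (+-suc (c * 3 ^ e) t)) (trans (cong (c * 3 ^ e ℕ.+_) 1+t≡q) eq′))
  solve₁ : ∀ q → 1 * q + q ≡ 2 * q + 0
  solve₁ = solve-∀
  solve₂ : ∀ q → 2 * q + q ≡ 1 * (3 * q) + 0
  solve₂ = solve-∀

-- Denominators as quotients by a gcd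

-- The witness N / gcd(N, g) is the denominator of g/N in lowest terms; it divides d because it is
-- coprime to g / gcd(N, g).
∣d*g⇔ : ∀ N g .{{_ : NonZero N}} → ∃[ α ] NonZero α × (∀ d → α ∣ d ⇔ N ∣ d * g)
∣d*g⇔ N g = α , α≢0 , λ d → mk⇔ (to d) (from d)
  where
  D = gcd N g
  instance
    D≢0 : NonZero D
    D≢0 = ≢-nonZero (λ D≡0 → ≢-nonZero⁻¹ N (gcd[m,n]≡0⇒m≡0 D≡0))
  α = N / D
  g′ = g / D
  αD≡N : D * α ≡ N
  αD≡N = m*[n/m]≡n (gcd[m,n]∣m N g)
  g′D≡g : D * g′ ≡ g
  g′D≡g = m*[n/m]≡n (gcd[m,n]∣n N g)
  α≢0 : NonZero α
  α≢0 = m*n≢0⇒n≢0 D {{subst NonZero (sym αD≡N) it}}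
    where
    it : NonZero N
    it = ≢-nonZero (≢-nonZero⁻¹ N)
  swap : ∀ d a b → d * (a * b) ≡ a * (b * d)
  swap = solve-∀
  dg≡ : ∀ d → d * g ≡ D * (g′ * d)
  dg≡ d = trans (cong (d *_) (sym g′D≡g)) (swap d D g′)
  to : ∀ d → α ∣ d → N ∣ d * g
  to d α∣d = subst₂ _∣_ αD≡N (sym (dg≡ d)) (*-monoʳ-∣ D (∣n⇒∣m*n g′ α∣d))
  from : ∀ d → N ∣ d * g → α ∣ d
  from d N∣dg = Coprime.coprime-divisor (Coprime.coprime-/gcd N g) (*-cancelˡ-∣ D (subst₂ _∣_ (sym αD≡N) (dg≡ d) N∣dg))

gcdBelow : ℕ → (ℕ → ℕ) → ℕ
gcdBelow zero    g = 0
gcdBelow (suc b) g = gcd (gcdBelow b g) (g b)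

-- Multiplication by d commutes with gcd, so finitely many conditions merge into one. The empty gcd
-- is 0, which imposes none.
∣d*gcdBelow⇔ : ∀ N d b g → N ∣ d * gcdBelow b g ⇔ (∀ s → s < b → N ∣ d * g s)
∣d*gcdBelow⇔ N d zero    g = mk⇔ (λ _ _ ()) (λ _ → subst (N ∣_) (sym (*-zeroʳ d)) (N ∣0))
∣d*gcdBelow⇔ N d (suc b) g = mk⇔ to′ from′
  where
  open Equivalence (∣d*gcdBelow⇔ N d b g)
  eq : d * gcd (gcdBelow b g) (g b) ≡ gcd (d * gcdBelow b g) (d * g b)
  eq = c*gcd[m,n]≡gcd[cm,cn] d (gcdBelow b g) (g b)
  to′ : N ∣ d * gcdBelow (suc b) g → ∀ s → s < suc b → N ∣ d * g s
  to′ N∣ s (s≤s s≤b) with m≤n⇒m<n∨m≡n s≤b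
  ... | inj₁ s<b  = to (∣-trans N∣ (*-monoʳ-∣ d (gcd[m,n]∣m (gcdBelow b g) (g b)))) s s<b
  ... | inj₂ refl = ∣-trans N∣ (*-monoʳ-∣ d (gcd[m,n]∣n (gcdBelow b g) (g b)))
  from′ : (∀ s → s < suc b → N ∣ d * g s) → N ∣ d * gcdBelow (suc b) g
  from′ h = subst (N ∣_) (sym eq) (gcd-greatest (from (λ s s<b → h s (m≤n⇒m≤1+n s<b))) (h b ≤-refl))

-- Finite sums

∑-cong : ∀ n {f g} → (∀ k → k < n → f k ≡ g k) → ∑ n f ≡ ∑ n g
∑-cong zero    h = refl
∑-cong (suc n) h = cong₂ _+_ (∑-cong n (λ k k<n → h k (m≤n⇒m≤1+n k<n))) (h n ≤-refl)

∑-zero : ∀ n {f} → (∀ k → f k ≡ 0) → ∑ n f ≡ 0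
∑-zero zero    h = refl
∑-zero (suc n) h = cong₂ _+_ (∑-zero n h) (h n)

∑-+ : ∀ n f g → ∑ n (λ k → f k + g k) ≡ ∑ n f + ∑ n g
∑-+ zero    f g = refl
∑-+ (suc n) f g = trans (cong (_+ (f n + g n)) (∑-+ n f g)) (interchange (∑ n f) (∑ n g) (f n) (g n))
  where
  interchange : ∀ a b c d → a + b + (c + d) ≡ a + c + (b + d)
  interchange = solve-∀

*-distribˡ-∑ : ∀ c n f → c * ∑ n f ≡ ∑ n (λ k → c * f k)
*-distribˡ-∑ c zero    f = *-zeroʳ c
*-distribˡ-∑ c (suc n) f = trans (*-distribˡ-+ c (∑ n f) (f n)) (cong (_+ c * f n) (*-distribˡ-∑ c n f))

∑-swap : ∀ m n (f : ℕ → ℕ → ℕ) → ∑ m (λ i → ∑ n (f i)) ≡ ∑ n (λ j → ∑ m (λ i → f i j))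
∑-swap zero    n f = sym (∑-zero n (λ _ → refl))
∑-swap (suc m) n f = trans (cong (_+ ∑ n (f m)) (∑-swap m n f)) (sym (∑-+ n (λ j → ∑ m (λ i → f i j)) (f m)))

∑-split : ∀ m n f → ∑ (m + n) f ≡ ∑ m f + ∑ n (λ k → f (m + k))
∑-split m zero    f = trans (cong (λ a → ∑ a f) (+-identityʳ m)) (sym (+-identityʳ (∑ m f)))
∑-split m (suc n) f = trans (cong (λ a → ∑ a f) (+-suc m n))
  (trans (cong (_+ f (m + n)) (∑-split m n f)) (+-assoc (∑ m f) _ _))

∑-∣ : ∀ {d} n {f} → (∀ k → k < n → d ∣ f k) → d ∣ ∑ n f
∑-∣ {d} zero h = d ∣0
∑-∣ (suc n) h = ∣m∣n⇒∣m+n (∑-∣ n (λ k k<n → h k (m≤n⇒m≤1+n k<n))) (h n ≤-refl)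

∑-head : ∀ n f → ∑ (suc n) f ≡ f 0 + ∑ n (f ∘ suc)
∑-head = ∑-split 1

-- Index k stands for the number k + 1, so the multiples q, 2q, ..., cq sit at the indices
-- `j * q + q′`. Blocks of length q are peeled off at the end, and everything between the multiples
-- goes into r.
∑-sparse : ∀ d {q q′} → q ≡ suc q′ → ∀ h c {t} → t < q →
  (∀ k → k < c * q + t → q ∤ suc k → d ∣ h k) →
  ∃[ r ] d ∣ r × ∑ (c * q + t) h ≡ ∑ c (λ j → h (j * q + q′)) + r
∑-sparse d {q} {q′} refl h zero {t} t<q small =
  ∑ t h , ∑-∣ t (λ k k<t → small k k<t (>⇒∤ (≤-<-trans k<t t<q))) , refl
∑-sparse d {q} {q′} refl h (suc c) {t} t<q small with ∑-sparse d {q} refl h c {0} (s≤s z≤n)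
  (λ k k< → small k (<-≤-trans k< (≤-trans (≤-reflexive (+-identityʳ (c * q))) (≤-trans (m≤n+m (c * q) q) (m≤m+n _ t)))))
... | r , d∣r , eq = r + (r′ + r″) , ∣m∣n⇒∣m+n d∣r (∣m∣n⇒∣m+n d∣r′ d∣r″) , (begin
  ∑ (suc c * q + t) h
    ≡⟨ ∑-split (suc c * q) t h ⟩
  ∑ (suc c * q) h + r″
    ≡⟨ cong (λ a → ∑ a h + r″) (trans (+-comm q (c * q)) (+-suc (c * q) q′)) ⟩
  ∑ (c * q + q′) h + h (c * q + q′) + r″
    ≡⟨ cong (λ a → a + h (c * q + q′) + r″) (∑-split (c * q) q′ h) ⟩
  ∑ (c * q) h + r′ + h (c * q + q′) + r″
    ≡⟨ cong (λ a → a + r′ + h (c * q + q′) + r″) (trans (cong (λ a → ∑ a h) (sym (+-identityʳ (c * q)))) eq) ⟩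
  ∑ c (λ j → h (j * q + q′)) + r + r′ + h (c * q + q′) + r″
    ≡⟨ rearrange (∑ c (λ j → h (j * q + q′))) r r′ (h (c * q + q′)) r″ ⟩
  ∑ (suc c) (λ j → h (j * q + q′)) + (r + (r′ + r″)) ∎)
  where
  r′ = ∑ q′ (λ k → h (c * q + k))
  r″ = ∑ t (λ k → h (suc c * q + k))
  rearrange : ∀ s r a x b → s + r + a + x + b ≡ s + x + (r + (a + b))
  rearrange = solve-∀
  not-multiple : ∀ a k → suc k < q → q ∤ suc (a * q + k)
  not-multiple a k k<q q∣ = >⇒∤ k<q (∣m+n∣m⇒∣n (subst (q ∣_) (sym (+-suc (a * q) k)) q∣) (n∣m*n a))
  d∣r′ : d ∣ r′
  d∣r′ = ∑-∣ q′ λ k k<q′ → small (c * q + k)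
    (<-≤-trans (+-monoʳ-< (c * q) k<q′) (≤-trans (+-monoʳ-≤ (c * q) (n≤1+n q′)) (≤-trans (≤-reflexive (+-comm (c * q) q)) (m≤m+n _ t))))
    (not-multiple c k (s≤s k<q′))
  d∣r″ : d ∣ r″
  d∣r″ = ∑-∣ t λ k k<t → small (suc c * q + k) (+-monoʳ-< (suc c * q) k<t) (not-multiple (suc c) k (≤-<-trans k<t t<q))

-- Binomial coefficients

[k+1]*[n+1]C[k+1]≡[n+1]*nCk : ∀ n k → suc k * (suc n C suc k) ≡ suc n * (n C k)
[k+1]*[n+1]C[k+1]≡[n+1]*nCk n       zero    =
  trans (*-identityˡ (suc n C 1)) (trans (nC1≡n (suc n)) (sym (*-identityʳ (suc n))))
[k+1]*[n+1]C[k+1]≡[n+1]*nCk zero    (suc k) =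
  trans (cong (suc (suc k) *_) (k>n⇒nCk≡0 {1} {suc (suc k)} (s≤s (s≤s z≤n)))) (*-zeroʳ (suc (suc k)))
[k+1]*[n+1]C[k+1]≡[n+1]*nCk (suc n) (suc k) = begin
  suc (suc k) * (suc (suc n) C suc (suc k))
    ≡⟨ cong (suc (suc k) *_) (nCk+nC[k+1]≡[n+1]C[k+1] (suc n) (suc k)) ⟨
  suc (suc k) * (a + (suc n C suc (suc k)))
    ≡⟨ *-distribˡ-+ (suc (suc k)) a _ ⟩
  (a + suc k * a) + suc (suc k) * (suc n C suc (suc k))
    ≡⟨ cong₂ (λ x y → (a + x) + y) ([k+1]*[n+1]C[k+1]≡[n+1]*nCk n k) ([k+1]*[n+1]C[k+1]≡[n+1]*nCk n (suc k)) ⟩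
  (a + suc n * (n C k)) + suc n * (n C suc k)
    ≡⟨ trans (+-assoc a _ _) (cong (a ℕ.+_) (sym (*-distribˡ-+ (suc n) (n C k) (n C suc k)))) ⟩
  a + suc n * ((n C k) + (n C suc k))
    ≡⟨ cong (λ x → a + suc n * x) (nCk+nC[k+1]≡[n+1]C[k+1] n k) ⟩
  suc (suc n) * a ∎
  where
  a = suc n C suc k

-- By absorption (s+1)·C(3^e, s+1) is a multiple of 3^e. Were the binomial coefficient prime to 3,
-- then 3^e would divide s + 1, which is smaller.
3∣[3^e]C[1+s] : ∀ e s → suc s < 3 ^ e → 3 ∣ (3 ^ e) C (suc s)
3∣[3^e]C[1+s] e s s<q with 3 ∣? (3 ^ e) C (suc s)
... | yes 3∣C = 3∣C
... | no  3∤C = contradiction (3^∣*⇒3^∣ e 3∤C q∣) (>⇒∤ s<q)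
  where
  instance _ = m^n≢0 3 e
  q∣ : 3 ^ e ∣ suc s * ((3 ^ e) C (suc s))
  q∣ = subst (λ q → q ∣ suc s * (q C suc s)) (suc-pred (3 ^ e))
    (subst (suc (pred (3 ^ e)) ∣_) (sym ([k+1]*[n+1]C[k+1]≡[n+1]*nCk (pred (3 ^ e)) s)) (m∣m*n _))

-- The bound N is kept apart from m so that one range of s serves every m = n - k when summations
-- are exchanged.
binomialSum : (ℕ → ℕ) → ℕ → ℕ → ℕ
binomialSum v N m = ∑ (suc N) (λ s → v s * (m C s))

binomialSum-zero : ∀ v N → binomialSum v N 0 ≡ v 0
binomialSum-zero v N = trans (∑-head N (λ s → v s * (0 C s)))
  (trans (cong₂ _+_ (*-identityʳ (v 0)) (∑-zero N (λ s → *-zeroʳ (v (suc s))))) (+-identityʳ (v 0)))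

-- Pascal's rule moved onto the weights. The shifted sum would need one more term at its end, which
-- vanishes because m < N.
binomialSum-suc : ∀ v {N m} → m < N → binomialSum v N (suc m) ≡ binomialSum (λ s → v s + v (suc s)) N m
binomialSum-suc v {N} {m} m<N = begin
  binomialSum v N (suc m)
    ≡⟨ ∑-head N (λ s → v s * (suc m C s)) ⟩
  v 0 * 1 + ∑ N (λ s → v (suc s) * (suc m C suc s))
    ≡⟨ cong (v 0 * 1 ℕ.+_) (trans (∑-cong N (λ s _ → pascal s)) (∑-+ N _ _)) ⟩
  v 0 * 1 + (∑ N (λ s → v (suc s) * (m C s)) + ∑ N (λ s → v (suc s) * (m C suc s)))
    ≡⟨ rearrange (v 0 * 1) (∑ N (λ s → v (suc s) * (m C s))) (∑ N (λ s → v (suc s) * (m C suc s))) ⟩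
  (v 0 * 1 + ∑ N (λ s → v (suc s) * (m C suc s))) + (∑ N (λ s → v (suc s) * (m C s)) + 0)
    ≡⟨ cong₂ _+_ (sym (∑-head N (λ s → v s * (m C s)))) (cong (∑ N (λ s → v (suc s) * (m C s)) ℕ.+_) (sym last≡0)) ⟩
  binomialSum v N m + binomialSum (v ∘ suc) N m
    ≡⟨ ∑-+ (suc N) (λ s → v s * (m C s)) (λ s → v (suc s) * (m C s)) ⟨
  ∑ (suc N) (λ s → v s * (m C s) + v (suc s) * (m C s))
    ≡⟨ ∑-cong (suc N) (λ s _ → sym (*-distribʳ-+ (m C s) (v s) (v (suc s)))) ⟩
  binomialSum (λ s → v s + v (suc s)) N m ∎
  where
  rearrange : ∀ a b c → a + (b + c) ≡ (a + c) + (b + 0)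
  rearrange = solve-∀
  pascal : ∀ s → v (suc s) * (suc m C suc s) ≡ v (suc s) * (m C s) + v (suc s) * (m C suc s)
  pascal s = trans (cong (v (suc s) *_) (sym (nCk+nC[k+1]≡[n+1]C[k+1] m s))) (*-distribˡ-+ (v (suc s)) (m C s) (m C suc s))
  last≡0 : v (suc N) * (m C N) ≡ 0
  last≡0 = trans (cong (v (suc N) *_) (k>n⇒nCk≡0 m<N)) (*-zeroʳ (v (suc N)))

binomialSum-const : ∀ c {N} m → m ≤ N → binomialSum (λ _ → c) N m ≡ c * 2 ^ m
binomialSum-const c {N} zero    _   = trans (binomialSum-zero (λ _ → c) N) (sym (*-identityʳ c))
binomialSum-const c {N} (suc m) m<N = trans (binomialSum-suc (λ _ → c) m<N)
  (trans (binomialSum-const (c + c) m (<⇒≤ m<N)) (double c (2 ^ m)))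
  where
  double : ∀ c x → (c + c) * x ≡ c * (2 * x)
  double = solve-∀

weight-+ : ∀ s → weight s + weight (suc s) ≡ 2
weight-+ 0             = refl
weight-+ 1             = refl
weight-+ (suc (suc s)) = weight-+ s

-- One Pascal step turns the weights 2, 0, 2, 0, ... into the constant 2, and a full row sum
-- remains. At exponent 0 the value would be `weight 0` = 2 instead of 1.
binomialSum-weight : ∀ {N} m → suc m ≤ N → binomialSum weight N (suc m) ≡ 2 ^ suc m
binomialSum-weight {N} m m<N = trans (binomialSum-suc weight m<N)
  (trans (∑-cong (suc N) (λ s _ → cong (_* (m C s)) (weight-+ s))) (binomialSum-const 2 m (<⇒≤ m<N)))

-- The numerators modulo 3 and 9

3∤2^ : ∀ k → 3 ∤ 2 ^ k
3∤2^ zero    = from-no (3 ∣? 1)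
3∤2^ (suc k) = 3∤* 2 (2 ^ k) (from-no (3 ∣? 2)) (3∤2^ k)

3^-odd : ∀ e → ∃[ a ] 3 ^ e ≡ suc (2 * a)
3^-odd zero = 0 , refl
3^-odd (suc e) with 3^-odd e
... | a , eq = suc (3 * a) , trans (cong (3 *_) eq) (rearrange a)
  where
  rearrange : ∀ a → 3 * suc (2 * a) ≡ suc (2 * suc (3 * a))
  rearrange = solve-∀

-- The exponent is odd, and 2·4^a + 1 grows by the multiple 6·4^a of 3 from a to a + 1.
3∣2^[3^e]+1 : ∀ e → 3 ∣ 2 ^ 3 ^ e + 1
3∣2^[3^e]+1 e with 3^-odd e
... | a , eq = subst (λ x → 3 ∣ x + 1) (trans (cong (2 *_) (^-*-assoc 2 2 a)) (cong (2 ^_) (sym eq))) (go a)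
  where
  step : ∀ x → 3 * (2 * x) + (2 * x + 1) ≡ 2 * (4 * x) + 1
  step = solve-∀
  go : ∀ a → 3 ∣ 2 * 4 ^ a + 1
  go zero    = ∣-refl
  go (suc a) = subst (3 ∣_) (step (4 ^ a)) (∣m∣n⇒∣m+n (m∣m*n (2 * 4 ^ a)) (go a))

-- Twice 2^(3^e) + 1, a multiple of 3, exceeds this number by exactly 1.
3∤2^[1+3^e]+1 : ∀ e → 3 ∤ 2 ^ suc (3 ^ e) + 1
3∤2^[1+3^e]+1 e 3∣ = from-no (3 ∣? 1) (∣m+n∣m⇒∣n
  (subst (3 ∣_) (double (2 ^ 3 ^ e)) (∣n⇒∣m*n 2 (3∣2^[3^e]+1 e))) 3∣)
  where
  double : ∀ x → 2 * (x + 1) ≡ 2 * x + 1 + 1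
  double = solve-∀

weight-odd : ∀ a → weight (suc (2 * a)) ≡ 0
weight-odd zero    = refl
weight-odd (suc a) = trans (cong (weight ∘ suc) (*-suc 2 a)) (weight-odd a)

module _ (n L : ℕ) (Y : ℕ → ℕ) (Y-spec : ∀ k → k ≤ n → suc k * Y k ≡ L) where

  total : ℕ
  total = ∑ (suc (suc n)) (λ s → weight s * Z n L Y Y-spec s)

  E : ℕ → ℕ
  E = binomialSum weight (suc n)

  total≡ : total ≡ ∑ (suc n) (λ k → E (n ∸ k) * Y k)
  total≡ = begin
    total
      ≡⟨ ∑-cong (suc (suc n)) (λ s _ → *-distribˡ-∑ (weight s) (suc n) _) ⟩
    ∑ (suc (suc n)) (λ s → ∑ (suc n) λ k → weight s * (((n ∸ k) C s) * Y k))
      ≡⟨ ∑-swap (suc (suc n)) (suc n) _ ⟩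
    ∑ (suc n) (λ k → ∑ (suc (suc n)) λ s → weight s * (((n ∸ k) C s) * Y k))
      ≡⟨ ∑-cong (suc n) (λ k _ → factor k) ⟩
    ∑ (suc n) (λ k → E (n ∸ k) * Y k) ∎
    where
    factor : ∀ k → ∑ (suc (suc n)) (λ s → weight s * (((n ∸ k) C s) * Y k)) ≡ E (n ∸ k) * Y k
    factor k = begin
      ∑ (suc (suc n)) (λ s → weight s * (((n ∸ k) C s) * Y k))
        ≡⟨ ∑-cong (suc (suc n)) (λ s _ → rotate (weight s) ((n ∸ k) C s) (Y k)) ⟩
      ∑ (suc (suc n)) (λ s → Y k * (weight s * ((n ∸ k) C s)))
        ≡⟨ *-distribˡ-∑ (Y k) (suc (suc n)) _ ⟨
      Y k * E (n ∸ k)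
        ≡⟨ *-comm (Y k) (E (n ∸ k)) ⟩
      E (n ∸ k) * Y k ∎
      where
      rotate : ∀ a b c → a * (b * c) ≡ c * (a * b)
      rotate = solve-∀

  3∤E : ∀ m → m ≤ n → 3 ∤ E m
  3∤E zero    _   = subst (3 ∤_) (sym (binomialSum-zero weight (suc n))) (from-no (3 ∣? 2))
  3∤E (suc m) m≤n = subst (3 ∤_) (sym (binomialSum-weight m (m≤n⇒m≤1+n m≤n))) (3∤2^ (suc m))

  -- In all uses `suc q` is a power of 3, and `j * suc q + q` is the index of its (j+1)-st multiple.
  -- The value of Y there is K/(j+1), stated as a product.
  Y[1+j]q : ∀ q {K} → L ≡ suc q * K → ∀ j → j * suc q + q ≤ n → suc j * Y (j * suc q + q) ≡ K
  Y[1+j]q q {K} L≡ j j≤ = *-cancelˡ-≡ _ _ (suc q) (begin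
    suc q * (suc j * y)          ≡⟨ rearrange q j y ⟩
    suc (j * suc q + q) * y      ≡⟨ Y-spec (j * suc q + q) j≤ ⟩
    L                            ≡⟨ L≡ ⟩
    suc q * K                    ∎)
    where
    y = Y (j * suc q + q)
    rearrange : ∀ q j y → suc q * (suc j * y) ≡ suc (j * suc q + q) * y
    rearrange = solve-∀

  -- If `Y k` were prime to 3, the whole factor 3^e of L would fall on k + 1.
  3∣Y : ∀ e {M} → L ≡ 3 ^ e * M → ∀ k → k ≤ n → 3 ^ e ∤ suc k → 3 ∣ Y k
  3∣Y e {M} L≡ k k≤n q∤k with 3 ∣? Y k
  ... | yes 3∣y = 3∣y
  ... | no  3∤y = contradiction (3^∣*⇒3^∣ e 3∤y (subst (3 ^ e ∣_) (sym (trans (Y-spec k k≤n) L≡)) (m∣m*n M))) q∤k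

  -- L now has one factor 3 more than the power that fails to divide k + 1. One factor comes from
  -- `3∣Y`, the other from the same argument for `Y k` divided by 3.
  9∣Y : ∀ e {M} → L ≡ 3 ^ suc e * M → ∀ k → k ≤ n → 3 ^ e ∤ suc k → 9 ∣ Y k
  9∣Y e {M} L≡ k k≤n q∤k with 3∣Y (suc e) L≡ k k≤n (λ 3q∣k → q∤k (m*n∣⇒n∣ 3 (3 ^ e) 3q∣k))
  ... | divides y y≡ with 3 ∣? y
  ...   | yes (divides c refl) = divides c (trans y≡ (*-assoc c 3 3))
  ...   | no  3∤y = contradiction (3^∣*⇒3^∣ e 3∤y (divides M (*-cancelˡ-≡ _ _ 3 (begin
      3 * (suc k * y)      ≡⟨ rearrange (suc k) y ⟩
      suc k * (y * 3)      ≡⟨ cong (suc k *_) y≡ ⟨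
      suc k * Y k          ≡⟨ trans (Y-spec k k≤n) L≡ ⟩
      3 * 3 ^ e * M        ≡⟨ rearrange′ (3 ^ e) M ⟩
      3 * (M * 3 ^ e)      ∎)))) q∤k
    where
    rearrange : ∀ a y → 3 * (a * y) ≡ a * (y * 3)
    rearrange = solve-∀
    rearrange′ : ∀ a m → 3 * a * m ≡ 3 * (m * a)
    rearrange′ = solve-∀

  module _ {q : ℕ} (e : ℕ) {M : ℕ} (q≡ : 3 ^ e ≡ suc q) (L≡ : L ≡ 3 ^ e * M) (3∤M : 3 ∤ M) where

    private
      L≡′ : L ≡ suc q * M
      L≡′ = trans L≡ (cong (_* M) q≡)

    -- Used with f = E(n - k) for the total and with f = C(n - k, s) for a single coefficient.
    leading-terms : ∀ (f : ℕ → ℕ) c {t} → t < suc q → suc n ≡ c * suc q + t →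
      ∃[ r ] 3 ∣ r × ∑ (suc n) (λ k → f k * Y k) ≡ ∑ c (λ j → f (j * suc q + q) * Y (j * suc q + q)) + r
    leading-terms f c {t} t<q n≡
      with ∑-sparse 3 refl (λ k → f k * Y k) c t<q (λ k k< q∤k →
        ∣n⇒∣m*n (f k) (3∣Y e L≡ k (s≤s⁻¹ (subst (k <_) (sym n≡) k<)) (subst (_∤ suc k) (sym q≡) q∤k)))
    ... | r , 3∣r , eq = r , 3∣r , trans (cong (λ a → ∑ a (λ k → f k * Y k)) n≡) eq

    -- Only the number 3^e survives; its Y-value is M, and its binomial sum is 2 or a power of 2.
    3∤total₁ : ∀ {t} → t < suc q → suc n ≡ 1 * suc q + t → 3 ∤ total
    3∤total₁ {t} t<q n≡ 3∣total with leading-terms (λ k → E (n ∸ k)) 1 t<q n≡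
    ... | r , 3∣r , eq = 3∤* (E (n ∸ q)) (Y q) (3∤E (n ∸ q) (m∸n≤m n q)) (subst (3 ∤_) (sym Yq≡M) 3∤M)
      (∣m+n∣m⇒∣n (subst (3 ∣_) (trans total≡ (trans eq (+-comm _ r))) 3∣total) 3∣r)
      where
      q≤n : q ≤ n
      q≤n = s≤s⁻¹ (subst (suc q ≤_) (sym n≡) (≤-trans (≤-reflexive (sym (*-identityˡ (suc q)))) (m≤m+n _ t)))
      Yq≡M : Y q ≡ M
      Yq≡M = trans (sym (*-identityˡ (Y q))) (Y[1+j]q q L≡′ 0 q≤n)

    -- The Y-value at 3^e is twice the one at 2·3^e, called `y₁`. A positive remainder t + 1 makes
    -- both binomial sums powers of 2, so the two terms combine to y₁·2^(t+1)·(2^(3^e + 1) + 1).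
    3∤total₂ : ∀ {t} → suc t < suc q → suc n ≡ 2 * suc q + suc t → 3 ∤ total
    3∤total₂ {t} t<q n≡ 3∣total with leading-terms (λ k → E (n ∸ k)) 2 t<q n≡
    ... | r , 3∣r , eq = 3∤* (y₁ * 2 ^ suc t) (2 ^ suc (suc q) + 1)
      (3∤* y₁ (2 ^ suc t) 3∤y₁ (3∤2^ (suc t)))
      (subst (λ a → 3 ∤ 2 ^ suc a + 1) q≡ (3∤2^[1+3^e]+1 e))
      (subst (3 ∣_) main≡ (∣m+n∣m⇒∣n (subst (3 ∣_) (trans total≡ (trans eq (+-comm _ r))) 3∣total) 3∣r))
      where
      k₁ = 1 * suc q + q
      y₁ = Y k₁
      n≡₀ : n ≡ q + suc (suc q + t)
      n≡₀ = suc-injective (trans n≡ (rearrange q t))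
        where
        rearrange : ∀ q t → 2 * suc q + suc t ≡ suc (q + suc (suc q + t))
        rearrange = solve-∀
      n≡₁ : n ≡ k₁ + suc t
      n≡₁ = suc-injective (trans n≡ (rearrange q t))
        where
        rearrange : ∀ q t → 2 * suc q + suc t ≡ suc (1 * suc q + q + suc t)
        rearrange = solve-∀
      q≤n : q ≤ n
      q≤n = subst (q ≤_) (sym n≡₀) (m≤m+n q _)
      k₁≤n : k₁ ≤ n
      k₁≤n = subst (k₁ ≤_) (sym n≡₁) (m≤m+n k₁ _)
      2y₁≡M : 2 * y₁ ≡ M
      2y₁≡M = Y[1+j]q q L≡′ 1 k₁≤n
      3∤y₁ : 3 ∤ y₁
      3∤y₁ 3∣y₁ = 3∤M (subst (3 ∣_) 2y₁≡M (∣n⇒∣m*n 2 3∣y₁))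
      Yq≡2y₁ : Y q ≡ 2 * y₁
      Yq≡2y₁ = trans (sym (*-identityˡ (Y q))) (trans (Y[1+j]q q L≡′ 0 q≤n) (sym 2y₁≡M))
      E₀ : E (n ∸ q) ≡ 2 ^ suc (suc q + t)
      E₀ = trans (cong E (trans (cong (_∸ q) n≡₀) (m+n∸m≡n q _)))
        (binomialSum-weight (suc q + t) (≤-trans (m≤n+m _ q) (≤-trans (≤-reflexive (sym n≡₀)) (n≤1+n n))))
      E₁ : E (n ∸ k₁) ≡ 2 ^ suc t
      E₁ = trans (cong E (trans (cong (_∸ k₁) n≡₁) (m+n∸m≡n k₁ _)))
        (binomialSum-weight t (≤-trans (m≤n+m _ k₁) (≤-trans (≤-reflexive (sym n≡₁)) (n≤1+n n))))
      rearrange : ∀ a b y → 0 + 2 * (a * b) * (2 * y) + 2 * b * y ≡ y * (2 * b) * (2 * a + 1)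
      rearrange = solve-∀
      main≡ : 0 + E (n ∸ q) * Y q + E (n ∸ k₁) * y₁ ≡ y₁ * 2 ^ suc t * (2 ^ suc (suc q) + 1)
      main≡ = begin
        0 + E (n ∸ q) * Y q + E (n ∸ k₁) * y₁
          ≡⟨ cong₂ (λ a b → 0 + a * b + E (n ∸ k₁) * y₁) E₀ Yq≡2y₁ ⟩
        0 + 2 ^ suc (suc q + t) * (2 * y₁) + E (n ∸ k₁) * y₁
          ≡⟨ cong₂ (λ a b → 0 + 2 * a * (2 * y₁) + b * y₁) (^-distribˡ-+-* 2 (suc q) t) E₁ ⟩
        0 + 2 * (2 ^ suc q * 2 ^ t) * (2 * y₁) + 2 * 2 ^ t * y₁
          ≡⟨ rearrange (2 ^ suc q) (2 ^ t) y₁ ⟩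
        y₁ * 2 ^ suc t * (2 ^ suc (suc q) + 1) ∎

    module _ (n≡ : suc n ≡ 2 * suc q + 0) where

      private
        k₁ = 1 * suc q + q
        n≡k₁ : n ≡ k₁
        n≡k₁ = suc-injective (trans n≡ (rearrange q))
          where
          rearrange : ∀ q → 2 * suc q + 0 ≡ suc (1 * suc q + q)
          rearrange = solve-∀
        q≤n : q ≤ n
        q≤n = subst (q ≤_) (sym n≡k₁) (m≤n+m q _)
        k₁≤n : k₁ ≤ n
        k₁≤n = ≤-reflexive (sym n≡k₁)
        n∸q : n ∸ q ≡ 3 ^ e
        n∸q = trans (cong (_∸ q) n≡k₁) (trans (m+n∸n≡m (1 * suc q) q) (trans (*-identityˡ (suc q)) (sym q≡)))
        n∸k₁ : n ∸ k₁ ≡ 0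
        n∸k₁ = m≤n⇒m∸n≡0 (≤-reflexive n≡k₁)
        Yq≡2Yk₁ : Y q ≡ 2 * Y k₁
        Yq≡2Yk₁ = trans (sym (*-identityˡ (Y q))) (trans (Y[1+j]q q L≡′ 0 q≤n) (sym (Y[1+j]q q L≡′ 1 k₁≤n)))

      -- The surviving terms are C(3^e, s)·2y and C(0, s)·y. They add up to 3y for s = 0; otherwise
      -- the second is 0 and 3 divides C(3^e, s), except for s = 3^e, where it is 1.
      3∣Z : ∀ s → s ≢ 3 ^ e → 3 ∣ Z n L Y Y-spec s
      3∣Z s s≢q with leading-terms (λ k → (n ∸ k) C s) 2 (s≤s z≤n) n≡
      ... | r , 3∣r , eq = subst (3 ∣_) (sym eq) (∣m∣n⇒∣m+n (3∣main s s≢q) 3∣r)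
        where
        3∣main : ∀ s → s ≢ 3 ^ e → 3 ∣ 0 + ((n ∸ q) C s) * Y q + ((n ∸ k₁) C s) * Y k₁
        3∣main zero    _   = divides (Y k₁) (trans (cong (λ a → 1 * a + 1 * Y k₁) Yq≡2Yk₁) (rearrange (Y k₁)))
          where
          rearrange : ∀ y → 1 * (2 * y) + 1 * y ≡ y * 3
          rearrange = solve-∀
        3∣main (suc s) s≢q = ∣m∣n⇒∣m+n
          (∣m⇒∣m*n (Y q) (subst (λ a → 3 ∣ a C suc s) (sym n∸q) 3∣C))
          (∣m⇒∣m*n (Y k₁) (subst (λ a → 3 ∣ a C suc s) (sym n∸k₁) (3 ∣0)))
          where
          3∣C : 3 ∣ (3 ^ e) C suc s
          3∣C with <-cmp (suc s) (3 ^ e)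
          ... | tri< s<q _ _ = 3∣[3^e]C[1+s] e s s<q
          ... | tri≈ _ s≡q _ = contradiction s≡q s≢q
          ... | tri> _ _ q<s = subst (3 ∣_) (sym (k>n⇒nCk≡0 q<s)) (3 ∣0)

      -- The exception s = 3^e is odd, where `weight` is 0.
      3∣weight*Z : ∀ s → 3 ∣ weight s * Z n L Y Y-spec s
      3∣weight*Z s with s ≟ 3 ^ e | 3^-odd e
      ... | yes refl | a , odd = subst (λ x → 3 ∣ x * Z n L Y Y-spec (3 ^ e)) (sym (trans (cong weight odd) (weight-odd a))) (3 ∣0)
      ... | no s≢q   | _       = ∣n⇒∣m*n (weight s) (3∣Z s s≢q)

  -- Here e is one less than the exponent of 3 in L, so 2·3^(e+1) appears as 6·3^e. Six terms
  -- survive modulo 9, with values 3M/(j+1) for j = 0, ..., 5.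
  9∤weight*Z : ∀ {q} e {M} → 3 ^ e ≡ suc q → L ≡ 3 ^ suc e * M → 3 ∤ M → suc n ≡ 6 * suc q + 0 →
    9 ∤ weight 0 * Z n L Y Y-spec 0
  9∤weight*Z {q} e {M} q≡ L≡ 3∤M n≡ 9∣2Z
    with ∑-sparse 9 refl (λ k → 1 * Y k) 6 (s≤s z≤n) (λ k k< q∤k →
        ∣n⇒∣m*n 1 (9∣Y e L≡ k (s≤s⁻¹ (subst (k <_) (sym n≡) k<)) (subst (_∤ suc k) (sym q≡) q∤k)))
  -- 3 divides 30 and 9 would divide 2S, so 27 would divide 30·2S = 9·(49·M), leaving 3 as a divisor
  -- of 49·M.
  ... | r , 9∣r , eq = 3∤* 49 M (from-no (3 ∣? 49)) 3∤M
    (*-cancelˡ-∣ 9 (subst (27 ∣_) harmonic (*-pres-∣ (from-yes (3 ∣? 30)) 9∣2S)))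
    where
    x : ℕ → ℕ
    x j = Y (j * suc q + q)
    S = ∑ 6 (λ j → 1 * x j)
    2Z≡ : 2 * Z n L Y Y-spec 0 ≡ 2 * r + 2 * S
    2Z≡ = trans (cong (2 *_) (trans (cong (λ a → ∑ a (λ k → 1 * Y k)) n≡) (trans eq (+-comm S r)))) (*-distribˡ-+ 2 r S)
    9∣2S : 9 ∣ 2 * S
    9∣2S = ∣m+n∣m⇒∣n (subst (9 ∣_) 2Z≡ 9∣2Z) (∣n⇒∣m*n 2 9∣r)
    L≡′ : L ≡ suc q * (3 * M)
    L≡′ = trans L≡ (trans (cong (λ a → 3 * a * M) q≡) (rearrange (suc q) M))
      where
      rearrange : ∀ a m → 3 * a * m ≡ a * (3 * m)
      rearrange = solve-∀
    x-spec : ∀ j → j < 6 → suc j * x j ≡ 3 * M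
    x-spec j (s≤s j≤5) = Y[1+j]q q L≡′ j (≤-trans (+-monoˡ-≤ q (*-monoˡ-≤ (suc q) j≤5)) (≤-reflexive (suc-injective (trans (rearrange q) (sym n≡)))))
      where
      rearrange : ∀ q → suc (5 * suc q + q) ≡ 6 * suc q + 0
      rearrange = solve-∀
    -- The factor 30·2 = 60 is lcm(1, ..., 6), so each 60/(j+1) is an integer; 60·(49/20) = 3·49
    -- yields the constant 49.
    weigh : ∀ x₀ x₁ x₂ x₃ x₄ x₅ →
      30 * (2 * (0 + 1 * x₀ + 1 * x₁ + 1 * x₂ + 1 * x₃ + 1 * x₄ + 1 * x₅)) ≡
      60 * (1 * x₀) + 30 * (2 * x₁) + 20 * (3 * x₂) + 15 * (4 * x₃) + 12 * (5 * x₄) + 10 * (6 * x₅)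
    weigh = solve-∀
    collect : ∀ m → 60 * (3 * m) + 30 * (3 * m) + 20 * (3 * m) + 15 * (3 * m) + 12 * (3 * m) + 10 * (3 * m) ≡ 9 * (49 * m)
    collect = solve-∀
    harmonic : 30 * (2 * S) ≡ 9 * (49 * M)
    harmonic = begin
      30 * (2 * S)
        ≡⟨ weigh (x 0) (x 1) (x 2) (x 3) (x 4) (x 5) ⟩
      60 * (1 * x 0) + 30 * (2 * x 1) + 20 * (3 * x 2) + 15 * (4 * x 3) + 12 * (5 * x 4) + 10 * (6 * x 5)
        ≡⟨ cong₂ _+_ (cong₂ _+_ (cong₂ _+_ (cong₂ _+_ (cong₂ _+_
             (cong (60 *_) (x-spec 0 (s≤s z≤n))) (cong (30 *_) (x-spec 1 (from-yes (1 <? 6)))))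
             (cong (20 *_) (x-spec 2 (from-yes (2 <? 6))))) (cong (15 *_) (x-spec 3 (from-yes (3 <? 6)))))
             (cong (12 *_) (x-spec 4 (from-yes (4 <? 6))))) (cong (10 *_) (x-spec 5 (from-yes (5 <? 6)))) ⟩
      60 * (3 * M) + 30 * (3 * M) + 20 * (3 * M) + 15 * (3 * M) + 12 * (3 * M) + 10 * (3 * M)
        ≡⟨ collect M ⟩
      9 * (49 * M) ∎

-- The denominator of A_{n,2}

module _ (n : ℕ) where

  private
    L = lcmUpTo (suc n)
    N = suc n ! * L
    instance
      L≢0 : NonZero L
      L≢0 = lcmUpTo≢0 (suc n)
      N≢0 : NonZero N
      N≢0 = m*n≢0 (suc n !) L {{suc n !≢0}}

    Y : ℕ → ℕ
    Y k = L / suc k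

    Y-spec : ∀ k → k ≤ n → suc k * Y k ≡ L
    Y-spec k k≤n = m*[n/m]≡n (1+k∣lcmUpTo (s≤s k≤n))

    g : ℕ → ℕ
    g s = weight s * Z n L Y Y-spec s

    annihilator : ∃[ α ] NonZero α × (∀ d → α ∣ d ⇔ N ∣ d * gcdBelow (suc (suc n)) g)
    annihilator = ∣d*g⇔ N (gcdBelow (suc (suc n)) g)

  denominator : ℕ
  denominator = proj₁ annihilator

  instance
    denominator≢0 : NonZero denominator
    denominator≢0 = proj₁ (proj₂ annihilator)

  private
    α = denominator

    α∣⇔ : ∀ d → α ∣ d ⇔ (∀ s → s < suc (suc n) → N ∣ d * g s)
    α∣⇔ d = ⇔-trans (proj₂ (proj₂ annihilator) d) (∣d*gcdBelow⇔ N d (suc (suc n)) g)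

    open Equivalence

    N∣αg : ∀ s → s < suc (suc n) → N ∣ α * g s
    N∣αg = to (α∣⇔ α) ∣-refl

  -- The number α divides every admissible e, so it is least in size as well.
  isDenominator : IsDenominator (A₂ (suc n)) denominator
  isDenominator = record
    { positive = >-nonZero⁻¹ α
    ; integral = from (integral⇔∣ n L Y Y-spec α) (λ s s≤ → N∣αg s (s≤s s≤))
    ; least    = λ e 0<e h → ∣⇒≤ {{>-nonZero 0<e}}
        (from (α∣⇔ e) (λ s s< → to (integral⇔∣ n L Y Y-spec e) h s (s≤s⁻¹ s<)))
    }

  denominator∣n!lcm : denominator ∣ suc n ! * lcmUpTo (suc n)
  denominator∣n!lcm = from (α∣⇔ N) (λ s _ → m∣m*n (g s))

  -- N divides every α·g s and hence α·`total`; with `total` prime to 3, the full power of 3 in N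
  -- must divide α.
  ν-denominator : 3 ∤ total n L Y Y-spec → ν 3 denominator ≡ ν 3 (suc n ! * lcmUpTo (suc n))
  ν-denominator 3∤total = ν-≡ α N (λ _ 3^e∣α → ∣-trans 3^e∣α denominator∣n!lcm)
    (λ e 3^e∣N → 3^∣*⇒3^∣ e 3∤total (∣-trans 3^e∣N N∣α*total))
    where
    N∣α*total : N ∣ α * total n L Y Y-spec
    N∣α*total = subst (N ∣_) (sym (*-distribˡ-∑ α (suc (suc n)) g)) (∑-∣ (suc (suc n)) N∣αg)

  -- All g s are multiples of 3, so α divides N/3. Writing g 0 = 3h with h prime to 3, N/3 divides
  -- α·h, so α has all factors 3 of N/3.
  ν-denominator-exceptional : ∀ e → suc n ≡ 2 * 3 ^ suc e →
    ν 3 denominator ≡ ν 3 (suc n ! * lcmUpTo (suc n)) ∸ 1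
  ν-denominator-exceptional e n≡ = go (lcmUpTo-3-part (suc e) (suc n) q≤n n<3q)
    where
    q≤n : 3 ^ suc e ≤ suc n
    q≤n = subst (3 ^ suc e ≤_) (sym n≡) (m≤m+n (3 ^ suc e) _)
    n<3q : suc n < 3 ^ suc (suc e)
    n<3q = subst (_< 3 ^ suc (suc e)) (sym n≡) (*-monoˡ-< (3 ^ suc e) {{m^n≢0 3 (suc e)}} (from-yes (2 <? 3)))
    go : ∃[ M ] L ≡ 3 ^ suc e * M × 3 ∤ M → ν 3 denominator ≡ ν 3 N ∸ 1
    go (M , L≡ , 3∤M) = trans
      (ν-≡ α N′ (λ _ 3^a∣α → ∣-trans 3^a∣α α∣N′) (λ a → N′⇒α a (3∣g 0)))
      (cong (_∸ 1) (sym (trans (cong (ν 3) N≡3N′) (ν[3m] N′))))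
      where
      N′ = suc n ! * (3 ^ e * M)
      rearrange : ∀ f q m → f * (3 * q * m) ≡ 3 * (f * (q * m))
      rearrange = solve-∀
      N≡3N′ : N ≡ 3 * N′
      N≡3N′ = trans (cong (suc n ! *_) L≡) (rearrange (suc n !) (3 ^ e) M)
      instance
        N′≢0 : NonZero N′
        N′≢0 = m*n≢0⇒n≢0 3 {{subst NonZero N≡3N′ N≢0}}
      q≡ : ∀ a → 3 ^ a ≡ suc (pred (3 ^ a))
      q≡ a = sym (suc-pred (3 ^ a) {{m^n≢0 3 a}})
      3∣g : ∀ s → 3 ∣ g s
      3∣g = 3∣weight*Z n L Y Y-spec (suc e) (q≡ (suc e)) L≡ 3∤M
        (trans n≡ (trans (cong (2 *_) (q≡ (suc e))) (sym (+-identityʳ _))))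
      9∤g₀ : 9 ∤ g 0
      9∤g₀ = 9∤weight*Z n L Y Y-spec e (q≡ e) L≡ 3∤M
        (trans n≡ (trans (double-triple (3 ^ e)) (cong (λ q → 6 * q + 0) (q≡ e))))
        where
        double-triple : ∀ q → 2 * (3 * q) ≡ 6 * q + 0
        double-triple = solve-∀
      α∣N′ : α ∣ N′
      α∣N′ = from (α∣⇔ N′) λ s _ → subst₂ _∣_ (sym (trans N≡3N′ (*-comm 3 N′))) refl (*-monoʳ-∣ N′ (3∣g s))
      N′⇒α : ∀ a → 3 ∣ g 0 → 3 ^ a ∣ N′ → 3 ^ a ∣ α
      N′⇒α a (divides h g₀≡) 3^a∣N′ =
        3^∣*⇒3^∣ a 3∤h (∣-trans 3^a∣N′ (*-cancelˡ-∣ 3 (subst₂ _∣_ N≡3N′ αg₀≡ (N∣αg 0 (s≤s z≤n)))))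
        where
        3∤h : 3 ∤ h
        3∤h (divides c h≡c*3) = 9∤g₀ (divides c (trans g₀≡ (trans (cong (_* 3) h≡c*3) (*-assoc c 3 3))))
        rotate : ∀ a h → a * (h * 3) ≡ 3 * (a * h)
        rotate = solve-∀
        αg₀≡ : α * g 0 ≡ 3 * (α * h)
        αg₀≡ = trans (cong (α *_) g₀≡) (rotate α h)

  -- Leading digit 2 with remainder 0 is excluded: there 3 does divide `total`.
  3∤total : ∀ e {t} → t < 3 ^ e → suc n ≡ 1 * 3 ^ e + t ⊎ (suc n ≡ 2 * 3 ^ e + t × t ≢ 0) → 3 ∤ total n L Y Y-spec
  3∤total e {t} t<q n≡ with lcmUpTo-3-part e (suc n) (q≤n n≡) (n<3q n≡)
    where
    q≤n : suc n ≡ 1 * 3 ^ e + t ⊎ (suc n ≡ 2 * 3 ^ e + t × t ≢ 0) → 3 ^ e ≤ suc n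
    q≤n (inj₁ n≡)       = subst (3 ^ e ≤_) (sym n≡) (≤-trans (m≤m+n (3 ^ e) 0) (m≤m+n _ t))
    q≤n (inj₂ (n≡ , _)) = subst (3 ^ e ≤_) (sym n≡) (≤-trans (m≤m+n (3 ^ e) _) (m≤m+n _ t))
    bound : ∀ {c} → c ≤ 2 → suc n ≡ c * 3 ^ e + t → suc n < 3 ^ suc e
    bound {c} c≤2 n≡ = subst₂ _<_ (sym n≡) (+-comm (2 * 3 ^ e) (3 ^ e)) (+-mono-≤-< (*-monoˡ-≤ (3 ^ e) c≤2) t<q)
    n<3q : suc n ≡ 1 * 3 ^ e + t ⊎ (suc n ≡ 2 * 3 ^ e + t × t ≢ 0) → suc n < 3 ^ suc e
    n<3q = [ bound (s≤s z≤n) , bound (s≤s (s≤s z≤n)) ∘ proj₁ ]′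
  ... | M , L≡ , 3∤M = go t t<q n≡
    where
    q≡ : 3 ^ e ≡ suc (pred (3 ^ e))
    q≡ = sym (suc-pred (3 ^ e) {{m^n≢0 3 e}})
    go : ∀ t → t < 3 ^ e → suc n ≡ 1 * 3 ^ e + t ⊎ (suc n ≡ 2 * 3 ^ e + t × t ≢ 0) → 3 ∤ total n L Y Y-spec
    go t t<q (inj₁ n≡) = 3∤total₁ n L Y Y-spec e q≡ L≡ 3∤M (subst (t <_) q≡ t<q)
      (trans n≡ (cong (λ q → 1 * q + t) q≡))
    go zero    t<q (inj₂ (n≡ , 0≢0)) = contradiction refl 0≢0
    go (suc t) t<q (inj₂ (n≡ , _))   = 3∤total₂ n L Y Y-spec e q≡ L≡ 3∤M (subst (suc t <_) q≡ t<q)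
      (trans n≡ (cong (λ q → 2 * q + suc t) q≡))

  -- This is 2·3^0. Its `total` is 6, a multiple of 3, so the general argument fails, but N = 4 is
  -- prime to 3 and both valuations are 0.
  ν-denominator-2 : suc n ≡ 2 → ν 3 denominator ≡ ν 3 (suc n ! * lcmUpTo (suc n))
  ν-denominator-2 n≡ = ν-≡ α N (λ _ 3^e∣α → ∣-trans 3^e∣α denominator∣n!lcm) 3^∣N⇒
    where
    3∤N : 3 ∤ N
    3∤N = subst (λ m → 3 ∤ m ! * lcmUpTo m) (sym n≡) (from-no (3 ∣? 4))
    3^∣N⇒ : ∀ e → 3 ^ e ∣ N → 3 ^ e ∣ α
    3^∣N⇒ zero    _     = 1∣ α
    3^∣N⇒ (suc e) 3^e∣N = contradiction (m*n∣⇒m∣ 3 (3 ^ e) 3^e∣N) 3∤N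

  ν-denominator-regular : ¬ (∃[ m ] 1 ≤ m × suc n ≡ 2 * 3 ^ m) →
    ν 3 denominator ≡ ν 3 (suc n ! * lcmUpTo (suc n))
  ν-denominator-regular ¬exceptional = go (leading-digit n)
    where
    go : (∃₂ λ e t → t < 3 ^ e × (suc n ≡ 1 * 3 ^ e + t ⊎ suc n ≡ 2 * 3 ^ e + t)) → ν 3 denominator ≡ ν 3 N
    go (e     , t     , t<q , inj₁ n≡) = ν-denominator (3∤total e t<q (inj₁ n≡))
    go (e     , suc t , t<q , inj₂ n≡) = ν-denominator (3∤total e t<q (inj₂ (n≡ , λ ())))
    go (zero  , zero  , _   , inj₂ n≡) = ν-denominator-2 n≡
    go (suc e , zero  , _   , inj₂ n≡) = contradiction (suc e , s≤s z≤n , trans n≡ (+-identityʳ _)) ¬exceptional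

corollary5p10 : ∀ (n : ℕ) → 1 ≤ n →
    ∃[ α ] IsDenominator (A₂ n) α
    × ((∃[ m ] 1 ≤ m × n ≡ 2 * 3 ^ m) → ν 3 α ≡ ν 3 (n ! * lcmUpTo n) ∸ 1)
    × (¬ (∃[ m ] 1 ≤ m × n ≡ 2 * 3 ^ m) → ν 3 α ≡ ν 3 (n ! * lcmUpTo n))
corollary5p10 (suc n) _ = denominator n , isDenominator n
  , (λ { (suc e , _ , n≡) → ν-denominator-exceptional n e n≡ })
  , ν-denominator-regular n
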